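{- Let $h\geq 5$ and $k\geq 3h+4$ be positive integers. Let $A$ be a finite set of $k$ integers such that $\min(A)=0$, $\gcd(A)=1$, and $|h^{\wedge}A| = hk-h^2+4$. Then $A=[0,k+2]\setminus\{x,y,z\}$, where $\{x,y,z\}$ is one of the sets $\{1,2,3\}$, $\{k-1,k,k+1\}$, $\{1,2,k+1\}$, $\{1,k,k+1\}$, $\{1,3,k+2\}$, $\{k-2,k,k+2\}$, $\{2,k,k+2\}$, $\{1,k-1,k+2\}$, $\{3,k+1,k+2\}$, $\{k-3,k+1,k+2\}$.
   Context: For a finite set $A$ of integers and a positive integer $h\le |A|$, the restricted $h$-fold sumset $h^{\wedge}A$ is the set of all sums of $h$ distinct elements of $A$. For integers $\alpha\le\beta$, $[\alpha,\beta]=\{x\in\mathbb{Z}:\alpha\le x\le\beta\}$. $\gcd(A)$ denotes the greatest common divisor of the elements of $A$. -}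

module Defs where

open import Data.Nat as ℕ using (ℕ; zero; suc)
open import Data.Integer as ℤ using (ℤ; +_; _-_; _≤_)
import Data.Nat.GCD
open import Data.List using (List; []; _∷_; map; length; deduplicate; _++_; foldr)
open import Data.List.Membership.Propositional using (_∈_; _∉_)
open import Data.Product using (_×_; _,_)
open import Relation.Nullary using (¬_)
open import Relation.Binary.PropositionalEquality using (_≡_)

-- all sublists of length h of a list (h-element sub-multisets chosen by position);
-- for a duplicate-free list these are exactly the h-element subsets
choose : ℕ → List ℤ → List (List ℤ)
choose zero    _        = [] ∷ []
choose (suc h) []       = []
choose (suc h) (a ∷ as) = map (a ∷_) (choose h as) ++ choose (suc h) as

sumℤ : List ℤ → ℤ
sumℤ = foldr ℤ._+_ (+ 0)

restrictedSumset : ℕ → List ℤ → List ℤ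
restrictedSumset h A = deduplicate ℤ._≟_ (map sumℤ (choose h A))

gcdList : List ℤ → ℕ
gcdList = foldr (λ a g → Data.Nat.GCD.gcd ℤ.∣ a ∣ g) 0

MinIsZero : List ℤ → Set
MinIsZero A = (+ 0 ∈ A) × (∀ a → a ∈ A → + 0 ≤ a)

IsIntervalMinus : List ℤ → ℕ → ℤ × ℤ × ℤ → Set
IsIntervalMinus A k (x , y , z) =
  ∀ n → (n ∈ A → (+ 0 ≤ n × n ≤ + (k ℕ.+ 2) × ¬ n ≡ x × ¬ n ≡ y × ¬ n ≡ z))
      × ((+ 0 ≤ n × n ≤ + (k ℕ.+ 2) × ¬ n ≡ x × ¬ n ≡ y × ¬ n ≡ z) → n ∈ A)

exceptionalTriples : ℕ → List (ℤ × ℤ × ℤ)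
exceptionalTriples k =
    (+ 1 , + 2 , + 3)
  ∷ (K - + 1 , K , K ℤ.+ + 1)
  ∷ (+ 1 , + 2 , K ℤ.+ + 1)
  ∷ (+ 1 , K , K ℤ.+ + 1)
  ∷ (+ 1 , + 3 , K ℤ.+ + 2)
  ∷ (K - + 2 , K , K ℤ.+ + 2)
  ∷ (+ 2 , K , K ℤ.+ + 2)
  ∷ (+ 1 , K - + 1 , K ℤ.+ + 2)
  ∷ (+ 3 , K ℤ.+ + 1 , K ℤ.+ + 2)
  ∷ (K - + 3 , K ℤ.+ + 1 , K ℤ.+ + 2)
  ∷ []
  where K = + k

{-# OPTIONS --safe #-}
module Submission where

open import Defs
open import Data.Bool using (Bool; true; false)
open import Data.Empty using (⊥; ⊥-elim)
open import Data.Integer as ℤ using (ℤ; +_)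
import Data.Integer.Properties as ℤ
open import Data.List using (List; []; _∷_; length; _++_; replicate; map; take; drop; upTo)
open import Data.List.Membership.Propositional using (_∈_; _∉_)
open import Data.List.Membership.Propositional.Properties
  using (∈-map⁺; ∈-map⁻; ∈-++⁺ˡ; ∈-++⁺ʳ; ∈-++⁻; ∈-∃++; ∈-upTo⁺; ∈-deduplicate⁺; ∈-deduplicate⁻)
open import Data.List.Properties
  using (length-++; ++-assoc; length-map; length-replicate; length-take; length-upTo; take++drop≡id; ∷-injectiveˡ)
open import Data.List.Relation.Binary.Permutation.Propositional as Perm using (_↭_; refl; prep; swap; ↭-sym; ↭⇒↭ₛ)
open import Data.List.Relation.Binary.Permutation.Propositional.Properties using (∈-resp-↭; ↭-length)
import Data.List.Relation.Binary.Permutation.Setoid.Properties as Permutation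
open import Data.List.Relation.Unary.All as All using (All; []; _∷_)
open import Data.List.Relation.Unary.All.Properties using (++⁺; replicate⁺)
open import Data.List.Relation.Unary.AllPairs using ([]; _∷_)
open import Data.List.Relation.Unary.Any using (Any; here; there)
open import Data.List.Relation.Unary.Linked using (Linked; _∷_)
open import Data.List.Relation.Unary.Sorted.TotalOrder.Properties using (Sorted⇒AllPairs)
open import Data.List.Relation.Unary.Unique.DecPropositional.Properties using (deduplicate-!)
open import Data.List.Relation.Unary.Unique.Propositional using (Unique)
import Data.List.Relation.Unary.Unique.Propositional.Properties as Unique
open import Data.Maybe as Maybe using (Maybe; just; nothing)
open import Data.Nat using (ℕ; zero; suc; _+_; _*_; _∸_; _≤_; _<_; z≤n; s≤s; s≤s⁻¹)
open import Data.Nat.Divisibility using (_∣_; _∣0; ∣m∣n⇒∣m+n; divides; ∣-refl; ∣1⇒≡1)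
open import Data.Nat.GCD using (gcd-greatest)
open import Data.Nat.Properties
open import Data.Nat.Solver using (module +-*-Solver)
open import Data.List.Sort ≤-decTotalOrder using (sort; sort-↭; sort-↗)
open import Data.Product using (Σ; ∃; _×_; _,_; proj₁; proj₂)
open import Data.Sum using (_⊎_; inj₁; inj₂)
open import Relation.Binary.Definitions using (tri<; tri≈; tri>)
open import Relation.Binary.PropositionalEquality
open import Relation.Nullary using (¬_)
open +-*-Solver using (solve; _:+_; _:*_; _:=_; con)

-- Put A in increasing order.  Moving one of the h chosen elements to the next, unchosen, place raises
-- the sum by one difference of A, and h (k − h) moves lead from the least sum to the greatest; the h (k − h) + 1
-- sums met on the way leave an excess of 3.  Suppose a move by f commutes with m moves by d.  Then these
-- m + 1 moves can be refined to pass through m further sums, unless f = j d with j ≤ m, in which case j − 1 are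
-- gained.  Gains along one way add up, so they total at most 3.
-- Four disjoint pairs of moves across two fixed differences away from the ends of A force those differences to be
-- equal, hence all but the three outermost on either side equal some d.  The i-th difference from an end
-- is crossed i times, and the gains there make it j d with i (j − 1) summing to at most 3 over
-- both ends.  Now gcd A = 1 gives d = 1, and the length of the interval containing h^A turns ≤ 3 into = 3,
-- which leaves ten choices.

-- Increasing paths and the interleaving of two arithmetic progressions

infixr 5 _∷⟨_⟩_

data Path (P : ℕ → Set) : ℕ → ℕ → ℕ → Set where
  [_]    : ∀ {s} → P s → Path P 0 s s
  _∷⟨_⟩_ : ∀ {n s t u} → P s → s < t → Path P n t u → Path P (suc n) s u

_▷_ : ∀ {P m n s t u} → Path P m s t → Path P n t u → Path P (m + n) s u
[ _ ]          ▷ q = q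
(p ∷⟨ s<t ⟩ r) ▷ q = p ∷⟨ s<t ⟩ (r ▷ q)

Path-map : ∀ {P Q : ℕ → Set} c → (∀ {s} → P s → Q (c + s)) →
           ∀ {n s t} → Path P n s t → Path Q n (c + s) (c + t)
Path-map c f [ p ]            = [ f p ]
Path-map c f (p ∷⟨ s<t ⟩ r) = f p ∷⟨ +-monoʳ-< c s<t ⟩ Path-map c f r

record Run (P : ℕ → Set) (d m s : ℕ) : Set where
  constructor run
  field point : ∀ j → j ≤ m → P (s + j * d)
open Run

run-shift : ∀ {P d m s} → Run P d (suc m) s → Run P d m (s + d)
run-shift {P} {d} {m} {s} r =
  run λ j j≤m → subst P (sym (+-assoc s d (j * d))) (point r (suc j) (s≤s j≤m))

run-head : ∀ {P d m s} → Run P d m s → P s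
run-head {P} {s = s} r = subst P (+-identityʳ s) (point r 0 z≤n)

straight : ∀ {P d} m {s} → 0 < d → Run P d m s → Path P m s (s + m * d)
straight {P} zero {s} d>0 r =
  subst (Path P 0 s) (sym (+-identityʳ s)) [ run-head r ]
straight {P} {d} (suc m) {s} d>0 r =
  subst (Path P (suc m) s) (+-assoc s d (m * d))
    (run-head r ∷⟨ m<m+n s d>0 ⟩ straight m d>0 (run-shift r))

-- As the offset lies strictly between 0 and `d`, the two progressions alternate and no point is
-- shared; the `r` further points of the upper one follow.
braid : ∀ {P d} p r {s t} → 0 < d → s < t → t < s + d →
        Run P d p s → Run P d (p + r) t → Path P (suc (p + p + r)) s (t + (p + r) * d)
braid zero r d>0 s<t t<s+d low high = run-head low ∷⟨ s<t ⟩ straight r d>0 high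
braid {P} {d} (suc p) r {s} {t} d>0 s<t t<s+d low high =
  subst₂ (λ n → Path P n s) steps (+-assoc t d ((p + r) * d))
    (run-head low ∷⟨ s<t ⟩ run-head high ∷⟨ t<s+d ⟩
      braid p r d>0 (+-monoˡ-< d s<t) (+-monoˡ-< d t<s+d) (run-shift low) (run-shift high))
  where
  steps : suc (suc (suc (p + p + r))) ≡ suc (suc p + suc p + r)
  steps = cong (λ x → suc (suc (x + r))) (sym (+-suc p p))

-- The part of {0, d, …, md} ∪ {f, f + d, …, f + md} that the chain of the m + 1 moves misses:
-- it is j ∸ 1 when f = j d with 1 ≤ j ≤ m, and m otherwise.
excess : ℕ → ℕ → ℕ → ℕ
excess zero    f d = 0
excess (suc m) f d with <-cmp f d
... | tri< _ _ _ = suc m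
... | tri≈ _ _ _ = 0
... | tri> _ _ _ = suc (excess m (f ∸ d) d)

-- The recursion in `excess` takes `d` away from `f` once for each unit gained; only the case of
-- equality stops it short of the cap `m`.
excess-multiple : ∀ m f d → excess m f d < m → f ≡ suc (excess m f d) * d
excess-multiple (suc m) f d lt with <-cmp f d
... | tri< _ _ _   = ⊥-elim (<-irrefl refl lt)
... | tri≈ _ f≡d _ = trans f≡d (sym (+-identityʳ d))
... | tri> _ _ f>d = trans (sym (m+[n∸m]≡n (<⇒≤ f>d)))
                       (cong (_+_ d) (excess-multiple m (f ∸ d) d (s≤s⁻¹ lt)))

-- Climb the lower run while the offset `f` exceeds `d`. If it then falls below `d`, the runs
-- alternate; if it equals `d`, the upper run contains all later points of the lower one.
weave : ∀ {P d} p r {s f} → 0 < d → 0 < f → Run P d p s → Run P d (p + r) (s + f) →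
        Path P (suc (p + r + excess p f d)) s (s + f + (p + r) * d)
weave {P} {d} zero r {s} {f} d>0 f>0 low high =
  subst (λ n → Path P n s (s + f + r * d)) (cong suc (sym (+-identityʳ r)))
    (run-head low ∷⟨ m<m+n s f>0 ⟩ straight r d>0 high)
weave {P} {d} (suc p) r {s} {f} d>0 f>0 low high with <-cmp f d
... | tri< f<d _ _ =
  subst (λ n → Path P n s (s + f + (suc p + r) * d))
    (solve 2 (λ p r → con 1 :+ (con 1 :+ p :+ (con 1 :+ p) :+ r)
                   := con 1 :+ (con 1 :+ p :+ r :+ (con 1 :+ p))) refl p r)
    (braid (suc p) r d>0 (m<m+n s f>0) (+-monoʳ-< s f<d) low high)
... | tri≈ _ _ _ =
  subst (λ n → Path P n s (s + f + (suc p + r) * d)) (cong suc (sym (+-identityʳ (suc p + r))))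
    (run-head low ∷⟨ m<m+n s f>0 ⟩ straight (suc p + r) d>0 high)
... | tri> _ _ f>d =
  subst₂ (λ n → Path P n s)
    (solve 3 (λ p r e → con 2 :+ (p :+ (con 1 :+ r) :+ e)
                     := con 1 :+ (con 1 :+ p :+ r :+ (con 1 :+ e))) refl p r (excess p (f ∸ d) d))
    (cong₂ (λ x y → x + y * d) offset (+-suc p r))
    -- One step along the lower run shortens that run alone, so the surplus of the upper run grows
    -- from `r` to `suc r`.
    (run-head low ∷⟨ m<m+n s d>0 ⟩
      weave p (suc r) d>0 (m<n⇒0<n∸m f>d) (run-shift low)
        (subst₂ (Run P d) (sym (+-suc p r)) (sym offset) high))
  where
  offset : s + d + (f ∸ d) ≡ s + f
  offset = trans (+-assoc s d (f ∸ d)) (cong (_+_ s) (m+[n∸m]≡n (<⇒≤ f>d)))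

-- Subsets as binary words, and the effect of one move

Word : Set
Word = List Bool

ones : Word → ℕ
ones []          = 0
ones (true  ∷ w) = suc (ones w)
ones (false ∷ w) = ones w

-- This is the sum of the positions of the chosen places, counted from 0. Every move raises it by 1
-- whatever the gaps, so it serves to count moves.
weight : Word → ℕ
weight []      = 0
weight (b ∷ w) = ones w + weight w

slack : List ℕ → Word → ℕ
slack (e ∷ E) (b ∷ w) = e * ones w + slack E w
slack _       _       = 0

-- A set a₀ = 0 < a₁ < … is stored as its list E of gaps eᵢ = aᵢ − aᵢ₋₁ − 1, and a choice of elements
-- as a word.  Pushing the t chosen elements above a gap across it contributes t (eᵢ + 1).
value : List ℕ → Word → ℕ
value E w = weight w + slack E w

data Move : List ℕ → Word → Word → ℕ → Set where
  here  : ∀ {e E w} → Move (e ∷ E) (true ∷ false ∷ w) (false ∷ true ∷ w) e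
  there : ∀ {e E b x y f} → Move E x y f → Move (e ∷ E) (b ∷ x) (b ∷ y) f

record SameShape (x y : Word) : Set where
  constructor shape
  field
    same-ones   : ones y ≡ ones x
    same-length : length y ≡ length x
open SameShape

shape-refl : ∀ {x} → SameShape x x
shape-refl = shape refl refl

shape-trans : ∀ {x y z} → SameShape x y → SameShape y z → SameShape x z
shape-trans (shape a b) (shape c d) = shape (trans c a) (trans d b)

ones-∷ : ∀ b {x y} → ones y ≡ ones x → ones (b ∷ y) ≡ ones (b ∷ x)
ones-∷ true  eq = cong suc eq
ones-∷ false eq = eq

shape-∷ : ∀ b {x y} → SameShape x y → SameShape (b ∷ x) (b ∷ y)
shape-∷ b (shape o l) = shape (ones-∷ b o) (cong suc l)

move-shape : ∀ {E x y f} → Move E x y f → SameShape x y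
move-shape here              = shape refl refl
move-shape (there {b = b} m) = shape-∷ b (move-shape m)

move-weight : ∀ {E x y f} → Move E x y f → weight y ≡ suc (weight x)
move-weight (here {w = w}) = refl
move-weight (there {x = x} m) =
  trans (cong₂ _+_ (same-ones (move-shape m)) (move-weight m)) (+-suc (ones x) (weight x))

move-slack : ∀ {E x y f} → Move E x y f → slack E y ≡ slack E x + f
move-slack (here {e} {[]} {w}) = solve 2 (λ e o → e :* (con 1 :+ o) :+ con 0 := e :* o :+ con 0 :+ e) refl e (ones w)
move-slack (here {e} {g ∷ E} {w}) =
  solve 4 (λ e o g s → e :* (con 1 :+ o) :+ (g :* o :+ s) := e :* o :+ (g :* o :+ s) :+ e) refl
    e (ones w) g (slack E w)
move-slack (there {e} {E} {b} {x} {y} {f} m) =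
  trans (cong₂ (λ o s → e * o + s) (same-ones (move-shape m)) (move-slack m))
        (sym (+-assoc (e * ones x) (slack E x) f))

move-value : ∀ {E x y f} → Move E x y f → value E y ≡ value E x + suc f
move-value {E} {x} {y} {f} m =
  trans (cong₂ _+_ (move-weight m) (move-slack m))
        (solve 3 (λ w s f → con 1 :+ w :+ (s :+ f) := w :+ s :+ (con 1 :+ f)) refl
          (weight x) (slack E x) f)

-- Chains of sums and their excess

Reach : List ℕ → Word → ℕ → Set
Reach E x s = Σ Word λ w → SameShape x w × value E w ≡ s

-- Increasing values through words of one shape; e counts the values gained over one-per-move.
record Chain (E : List ℕ) (x y : Word) (e : ℕ) : Set where
  constructor chain
  field
    {steps}    : ℕ
    path       : Path (Reach E x) steps (value E x) (value E y)
    count      : steps + weight x ≡ weight y + e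
    same-shape : SameShape x y

reach-transport : ∀ {E x y s} → SameShape x y → Reach E y s → Reach E x s
reach-transport xy (w , yw , eq) = w , shape-trans xy yw , eq

chain-refl : ∀ {E x} → Chain E x x 0
chain-refl {E} {x} = chain [ x , shape-refl , refl ] (sym (+-identityʳ (weight x))) shape-refl

infixr 4 _⨾_
_⨾_ : ∀ {E x y z e f} → Chain E x y e → Chain E y z f → Chain E x z (e + f)
_⨾_ {E} {x} {y} {z} {e} {f} (chain {m} p cp xy) (chain {n} q cq yz) =
  chain (p ▷ Path-map 0 (reach-transport {E} xy) q) count (shape-trans xy yz)
  where
  open ≡-Reasoning
  count : m + n + weight x ≡ weight z + (e + f)
  count = begin
    m + n + weight x    ≡⟨ solve 3 (λ m n w → m :+ n :+ w := n :+ (m :+ w)) refl m n (weight x) ⟩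
    n + (m + weight x)  ≡⟨ cong (_+_ n) cp ⟩
    n + (weight y + e)  ≡⟨ sym (+-assoc n (weight y) e) ⟩
    n + weight y + e    ≡⟨ cong (_+ e) cq ⟩
    weight z + f + e    ≡⟨ solve 3 (λ w f e → w :+ f :+ e := w :+ (e :+ f)) refl (weight z) f e ⟩
    weight z + (e + f)  ∎

-- The number of ones behind the new letter is constant along the chain, so all values shift by one
-- constant, `suc d` for each of these ones.
chain-∷ : ∀ {d E x y e} b → Chain E x y e → Chain (d ∷ E) (b ∷ x) (b ∷ y) e
chain-∷ {d} {E} {x} {y} {e} b (chain {n} p c xy) =
  chain (subst₂ (Path _ n) (lifted x refl) (lifted y (same-ones xy)) (Path-map shift lift p))
        count (shape-∷ b xy)
  where
  shift : ℕ
  shift = ones x + d * ones x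
  lifted : ∀ w → ones w ≡ ones x → shift + value E w ≡ value (d ∷ E) (b ∷ w)
  lifted w eq rewrite eq =
    solve 4 (λ o p w s → o :+ p :+ (w :+ s) := o :+ w :+ (p :+ s)) refl
      (ones x) (d * ones x) (weight w) (slack E w)
  lift : ∀ {s} → Reach E x s → Reach (d ∷ E) (b ∷ x) (shift + s)
  lift (w , xw , eq) = b ∷ w , shape-∷ b xw , trans (sym (lifted w (same-ones xw))) (cong (_+_ shift) eq)
  count : n + (ones x + weight x) ≡ ones y + weight y + e
  count rewrite same-ones xy =
    trans (solve 3 (λ n o w → n :+ (o :+ w) := o :+ (n :+ w)) refl n (ones x) (weight x))
      (trans (cong (_+_ (ones x)) c) (sym (+-assoc (ones x) (weight y) e)))

chain-++ : ∀ {E x y e} P u → length u ≡ length P → Chain E x y e → Chain (P ++ E) (u ++ x) (u ++ y) e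
chain-++ []      []      _  c = c
chain-++ (_ ∷ P) (b ∷ u) eq c = chain-∷ b (chain-++ P u (suc-injective eq) c)

chain-move : ∀ {E x y f} → Move E x y f → Chain E x y 0
chain-move {E} {x} {y} {f} m =
  chain ((x , shape-refl , refl) ∷⟨ subst (value E x <_) (sym (move-value m)) (m<m+n _ (s≤s z≤n)) ⟩
          [ y , move-shape m , refl ])
        (sym (trans (+-identityʳ (weight y)) (move-weight m)))
        (move-shape m)

data Moves (E : List ℕ) (d : ℕ) : ℕ → Word → Word → Set where
  []  : ∀ {x} → Moves E d 0 x x
  _∷_ : ∀ {m x y z} → Move E x y d → Moves E d m y z → Moves E d (suc m) x z

moves-run : ∀ {E d m x y} → Moves E d m x y → Run (Reach E x) (suc d) m (value E x)
moves-run {E} {d} {m} {x} ms = run (reached ms)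
  where
  reached : ∀ {m x y} → Moves E d m x y → ∀ j → j ≤ m → Reach E x (value E x + j * suc d)
  reached {x = x} _         zero    _         = x , shape-refl , sym (+-identityʳ _)
  reached {x = x} (m₁ ∷ ms) (suc j) (s≤s j≤m) with reached ms j j≤m
  ... | w , yw , eq = w , shape-trans (move-shape m₁) yw ,
    trans eq (trans (cong (_+ j * suc d) (move-value m₁)) (+-assoc (value E x) (suc d) (j * suc d)))

moves-value : ∀ {E d m x y} → Moves E d m x y → value E y ≡ value E x + m * suc d
moves-value []                    = sym (+-identityʳ _)
moves-value {E} {d} {suc m} {x} (m₁ ∷ ms) =
  trans (moves-value ms) (trans (cong (_+ m * suc d) (move-value m₁)) (+-assoc (value E x) (suc d) (m * suc d)))

moves-weight : ∀ {E d m x y} → Moves E d m x y → weight y ≡ m + weight x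
moves-weight []                 = refl
moves-weight {m = suc m} (m₁ ∷ ms) = trans (moves-weight ms) (trans (cong (_+_ m) (move-weight m₁)) (+-suc m _))

moves-shape : ∀ {E d m x y} → Moves E d m x y → SameShape x y
moves-shape []        = shape-refl
moves-shape (m ∷ ms) = shape-trans (move-shape m) (moves-shape ms)

-- The move x → y and the m moves out of x commute, so every point of two shifted runs is reached.
chain-block : ∀ {E d f m x x′ y y′} → Move E x y f → Moves E d m x x′ → Moves E d m y y′ →
              Chain E x y′ (excess m (suc f) (suc d))
chain-block {E} {d} {f} {m} {x} {x′} {y} {y′} move low high =
  chain (subst₂ (λ n → Path (Reach E x) n (value E x)) refl target
          (weave m 0 (s≤s z≤n) (s≤s z≤n) (moves-run low)
            (subst₂ (Run (Reach E x) (suc d)) (sym (+-identityʳ m)) (move-value move)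
              (run λ j j≤m → reach-transport {E} (move-shape move) (point (moves-run high) j j≤m)))))
        count
        (shape-trans (move-shape move) (moves-shape high))
  where
  target : value E x + suc f + (m + 0) * suc d ≡ value E y′
  target = trans (cong₂ (λ v n → v + n * suc d) (sym (move-value move)) (+-identityʳ m)) (sym (moves-value high))
  count : suc (m + 0 + excess m (suc f) (suc d)) + weight x ≡ weight y′ + excess m (suc f) (suc d)
  count = trans
    (solve 3 (λ m e w → con 1 :+ (m :+ con 0 :+ e) :+ w := m :+ (con 1 :+ w) :+ e) refl
      m (excess m (suc f) (suc d)) (weight x))
    (cong (_+ excess m (suc f) (suc d))
      (sym (trans (moves-weight high) (cong (_+_ m) (move-weight move)))))

-- Moves by computation

-- An evaluator for moves, so that the explicit chains below are checked by `refl` with symbolic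
-- gaps and an arbitrary tail.
move : List ℕ → ℕ → Word → Maybe (Word × ℕ)
move (e ∷ E) zero    (true ∷ false ∷ w) = just (false ∷ true ∷ w , e)
move (_ ∷ E) (suc i) (b ∷ w)            = Maybe.map (λ (v , f) → b ∷ v , f) (move E i w)
move _       _       _                  = nothing

moves : List ℕ → List ℕ → Word → Maybe (Word × List ℕ)
moves E []       w = just (w , [])
moves E (i ∷ is) w with move E i w
... | nothing      = nothing
... | just (v , f) = Maybe.map (λ (u , fs) → u , f ∷ fs) (moves E is v)

move-sound : ∀ E i x {y f} → move E i x ≡ just (y , f) → Move E x y f
move-sound (e ∷ E) zero    (true ∷ false ∷ w) refl = here
move-sound (e ∷ E) (suc i) (b ∷ w) eq with move E i w in eq′
move-sound (e ∷ E) (suc i) (b ∷ w) refl | just _ = there (move-sound E i w eq′)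

moves-sound : ∀ E is x {y d} → moves E is x ≡ just (y , replicate (length is) d) →
              Moves E d (length is) x y
moves-sound E []       x refl = []
moves-sound E (i ∷ is) x eq with move E i x in eq₁
... | just (v , f) with moves E is v in eq₂
moves-sound E (i ∷ is) x refl | just (v , f) | just (u , _) = move-sound E i x eq₁ ∷ moves-sound E is v eq₂

walk : ∀ {E x} is {y fs} → moves E is x ≡ just (y , fs) → Chain E x y 0
walk []       refl = chain-refl
walk {E} {x} (i ∷ is) eq with move E i x in eq₁
... | just (v , f) with moves E is v in eq₂
walk {E} {x} (i ∷ is) refl | just (v , f) | just _ = chain-move (move-sound E i x eq₁) ⨾ walk is eq₂

block : ∀ {E x} i js {x′ y y′ f d} → move E i x ≡ just (y , f) →
        moves E js x ≡ just (x′ , replicate (length js) d) →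
        moves E js y ≡ just (y′ , replicate (length js) d) →
        Chain E x y′ (excess (length js) (suc f) (suc d))
block {E} {x} i js {y = y} p q r = chain-block (move-sound E i x p) (moves-sound E js x q) (moves-sound E js y r)

-- The order generated by moves, with its least and greatest words

infix 4 _⊑_
-- Unlike `Chain` it does not mention the gaps; it supplies the connecting stretches on which no
-- gain is claimed.
data _⊑_ : Word → Word → Set where
  ⊑-refl  : ∀ {x} → x ⊑ x
  ⊑-swap  : ∀ {w} → true ∷ false ∷ w ⊑ false ∷ true ∷ w
  ⊑-∷     : ∀ b {x y} → x ⊑ y → b ∷ x ⊑ b ∷ y
  ⊑-trans : ∀ {x y z} → x ⊑ y → y ⊑ z → x ⊑ z

⊑-shape : ∀ {x y} → x ⊑ y → SameShape x y
⊑-shape ⊑-refl        = shape-refl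
⊑-shape ⊑-swap        = shape refl refl
⊑-shape (⊑-∷ b r)     = shape-∷ b (⊑-shape r)
⊑-shape (⊑-trans r s) = shape-trans (⊑-shape r) (⊑-shape s)

⊑-chain : ∀ {E x y} → length x ≡ suc (length E) → x ⊑ y → Chain E x y 0
⊑-chain len ⊑-refl = chain-refl
⊑-chain {e ∷ E} len ⊑-swap = chain-move here
⊑-chain {[]} {_ ∷ []} {_ ∷ []} len (⊑-∷ b r) = chain-refl
⊑-chain {[]} {_ ∷ []} {_ ∷ _ ∷ _} len (⊑-∷ b r) with () ← same-length (⊑-shape r)
⊑-chain {e ∷ E} len (⊑-∷ b r) = chain-∷ b (⊑-chain (suc-injective len) r)
⊑-chain len (⊑-trans r s) = ⊑-chain len r ⨾ ⊑-chain (trans (same-length (⊑-shape r)) len) s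

bottom top : ℕ → ℕ → Word
bottom a b = replicate a true ++ replicate b false
top    a b = replicate b false ++ replicate a true

bottom-bubble : ∀ a b → bottom a (suc b) ⊑ false ∷ bottom a b
bottom-bubble zero    b = ⊑-refl
bottom-bubble (suc a) b = ⊑-trans (⊑-∷ true (bottom-bubble a b)) ⊑-swap

top-bubble : ∀ a b → true ∷ top a b ⊑ top (suc a) b
top-bubble a zero    = ⊑-refl
top-bubble a (suc b) = ⊑-trans ⊑-swap (⊑-∷ false (top-bubble a b))

ones≤length : ∀ x → ones x ≤ length x
ones≤length []          = z≤n
ones≤length (true  ∷ x) = s≤s (ones≤length x)
ones≤length (false ∷ x) = m≤n⇒m≤1+n (ones≤length x)

-- A leading one of `x` is already in place; a leading zero is fetched through the block of ones by
-- `bottom-bubble`.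
bottom-⊑ : ∀ a b x → ones x ≡ a → length x ≡ a + b → bottom a b ⊑ x
bottom-⊑ zero    zero    [] refl refl = ⊑-refl
bottom-⊑ (suc a) b       (true ∷ x) o l = ⊑-∷ true (bottom-⊑ a b x (suc-injective o) (suc-injective l))
bottom-⊑ a       (suc b) (false ∷ x) o l =
  ⊑-trans (bottom-bubble a b) (⊑-∷ false (bottom-⊑ a b x o (suc-injective (trans l (+-suc a b)))))
bottom-⊑ a       zero    (false ∷ x) o l =
  ⊥-elim (<⇒≱ (subst (_≤ length (false ∷ x)) (cong suc o) (s≤s (ones≤length x)))
              (≤-reflexive (trans l (+-identityʳ a))))

top-⊒ : ∀ a b x → ones x ≡ a → length x ≡ a + b → x ⊑ top a b
top-⊒ zero    zero    [] refl refl = ⊑-refl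
top-⊒ (suc a) b       (true ∷ x) o l =
  ⊑-trans (⊑-∷ true (top-⊒ a b x (suc-injective o) (suc-injective l))) (top-bubble a b)
top-⊒ a       (suc b) (false ∷ x) o l = ⊑-∷ false (top-⊒ a b x o (suc-injective (trans l (+-suc a b))))
top-⊒ a       zero    (false ∷ x) o l =
  ⊥-elim (<⇒≱ (subst (_≤ length (false ∷ x)) (cong suc o) (s≤s (ones≤length x)))
              (≤-reflexive (trans l (+-identityʳ a))))

ones-++ : ∀ x y → ones (x ++ y) ≡ ones x + ones y
ones-++ []          y = refl
ones-++ (true  ∷ x) y = cong suc (ones-++ x y)
ones-++ (false ∷ x) y = ones-++ x y

ones-true : ∀ n → ones (replicate n true) ≡ n
ones-true zero    = refl
ones-true (suc n) = cong suc (ones-true n)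

ones-false : ∀ n → ones (replicate n false) ≡ 0
ones-false zero    = refl
ones-false (suc n) = ones-false n

ones-bottom : ∀ a b → ones (bottom a b) ≡ a
ones-bottom a b = trans (ones-++ (replicate a true) (replicate b false))
                    (trans (cong₂ _+_ (ones-true a) (ones-false b)) (+-identityʳ a))

length-bottom : ∀ a b → length (bottom a b) ≡ a + b
length-bottom a b = trans (length-++ (replicate a true)) (cong₂ _+_ (length-replicate a) (length-replicate b))

ones-top : ∀ a b → ones (top a b) ≡ a
ones-top a b = trans (ones-++ (replicate b false) (replicate a true)) (cong₂ _+_ (ones-false b) (ones-true a))

length-top : ∀ a b → length (top a b) ≡ a + b
length-top a b = trans (length-++ (replicate b false))
                   (trans (cong₂ _+_ (length-replicate b) (length-replicate a)) (+-comm b a))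

weight-false : ∀ b → weight (replicate b false) ≡ 0
weight-false zero    = refl
weight-false (suc b) = cong₂ _+_ (ones-false b) (weight-false b)

weight-bottom : ∀ a b → weight (bottom a b) ≡ weight (replicate a true)
weight-bottom zero    b = weight-false b
weight-bottom (suc a) b = cong₂ _+_ (trans (ones-bottom a b) (sym (ones-true a))) (weight-bottom a b)

-- Each of the `a` ones passes each of the `b` zeros once, so every way from least to greatest takes
-- `a * b` moves.
weight-top : ∀ a b → weight (top a b) ≡ a * b + weight (bottom a b)
weight-top a zero = trans (sym (weight-bottom a 0)) (cong (_+ weight (bottom a 0)) (sym (*-zeroʳ a)))
weight-top a (suc b) = begin
  ones (top a b) + weight (top a b)          ≡⟨ cong₂ _+_ (ones-top a b) (weight-top a b) ⟩
  a + (a * b + weight (bottom a b))          ≡⟨ sym (+-assoc a (a * b) _) ⟩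
  a + a * b + weight (bottom a b)            ≡⟨ cong₂ _+_ (sym (*-suc a b)) (trans (weight-bottom a b) (sym (weight-bottom a (suc b)))) ⟩
  a * suc b + weight (bottom a (suc b))      ∎
  where open ≡-Reasoning

-- Explicit chains: the two corners and the diamonds

-- The summands follow the order of the blocks in the corner chains. The outermost gap occurs once,
-- so its excess may be as large as 3 and is measured with cap 4; the others occur two and three
-- times, which leaves at most 1 each, and cap 2 suffices.
left-excess right-excess : ℕ → ℕ → ℕ → ℕ → ℕ
left-excess p₁ p₂ p₃ d =
  excess 2 (suc p₃) (suc d) + (excess 2 (suc p₂) (suc d) + (excess 4 (suc p₁) (suc d) +
    (excess 2 (suc p₃) (suc d) + (excess 2 (suc p₂) (suc d) + (excess 2 (suc p₃) (suc d) + 0)))))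
right-excess q₁ q₂ q₃ d =
  excess 2 (suc q₃) (suc d) + (excess 2 (suc q₂) (suc d) + (excess 2 (suc q₃) (suc d) +
    (excess 4 (suc q₁) (suc d) + (excess 2 (suc q₂) (suc d) + (excess 2 (suc q₃) (suc d) + 0)))))

-- View a word as a partition in the 5 × 7 box: index i moves add a cell of content i − 4.  The three
-- outermost gaps are the 1 + 2 + 3 cells of one corner, and each is added beside cells of the constant gap d.
left-corner : ∀ {d p₁ p₂ p₃ Q v} →
  Chain (p₁ ∷ p₂ ∷ p₃ ∷ replicate 8 d ++ Q) (bottom 5 7 ++ v) (top 5 7 ++ v)
    (left-excess p₁ p₂ p₃ d)
left-corner =
    walk (4 ∷ 3 ∷ []) refl
  ⨾ block 2 (5 ∷ 6 ∷ []) refl refl refl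
  ⨾ block 1 (7 ∷ 8 ∷ []) refl refl refl
  ⨾ block 0 (9 ∷ 10 ∷ 4 ∷ 5 ∷ []) refl refl refl
  ⨾ walk (3 ∷ []) refl
  ⨾ block 2 (6 ∷ 7 ∷ []) refl refl refl
  ⨾ block 1 (8 ∷ 9 ∷ []) refl refl refl
  ⨾ walk (4 ∷ 3 ∷ []) refl
  ⨾ block 2 (5 ∷ 6 ∷ []) refl refl refl
  ⨾ walk (7 ∷ 8 ∷ 4 ∷ 5 ∷ 6 ∷ 7 ∷ 3 ∷ 4 ∷ 5 ∷ 6 ∷ []) refl

-- The opposite corner of the box: index 10 is crossed once, index 9 twice and index 8 three times,
-- each time beside moves over gaps `d`.
right-corner : ∀ {d q₁ q₂ q₃} →
  Chain (replicate 8 d ++ q₃ ∷ q₂ ∷ q₁ ∷ []) (bottom 5 7) (top 5 7)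
    (right-excess q₁ q₂ q₃ d)
right-corner =
    walk (4 ∷ 5 ∷ 6 ∷ 7 ∷ 3 ∷ 4 ∷ 5 ∷ 6 ∷ 2 ∷ 3 ∷ []) refl
  ⨾ block 8 (4 ∷ 5 ∷ []) refl refl refl
  ⨾ walk (7 ∷ 6 ∷ []) refl
  ⨾ block 9 (1 ∷ 2 ∷ []) refl refl refl
  ⨾ block 8 (3 ∷ 4 ∷ []) refl refl refl
  ⨾ walk (7 ∷ []) refl
  ⨾ block 10 (5 ∷ 6 ∷ 0 ∷ 1 ∷ []) refl refl refl
  ⨾ block 9 (2 ∷ 3 ∷ []) refl refl refl
  ⨾ block 8 (4 ∷ 5 ∷ []) refl refl refl
  ⨾ walk (7 ∷ 6 ∷ []) refl

fourfold : ℕ → ℕ → ℕ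
fourfold f d = e + (e + (e + (e + 0))) where e = excess 1 (suc f) (suc d)

-- With cap 1 the excess vanishes exactly when the gaps agree; otherwise four copies of it already
-- exceed 3.
fourfold≤3 : ∀ f d → fourfold f d ≤ 3 → f ≡ d
fourfold≤3 f d le with excess 1 (suc f) (suc d) in eq
... | zero  = suc-injective (trans (excess-multiple 1 (suc f) (suc d) (subst (_< 1) (sym eq) (s≤s z≤n)))
                (trans (cong (λ x → suc x * suc d) eq) (+-identityʳ (suc d))))
... | suc x = ⊥-elim (<⇒≱ (four x) le)
  where
  four : ∀ x → 4 ≤ suc x + (suc x + (suc x + (suc x + 0)))
  four x = +-mono-≤ {1} (s≤s z≤n) (+-mono-≤ {1} (s≤s z≤n) (+-mono-≤ {1} {_} {1} (s≤s z≤n) (s≤s z≤n)))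

-- Between the least and the greatest word of the window, the gaps with indices 3 to 6 are the ones
-- crossed at least four times. Moves over neighbouring gaps need not commute, so only the pairs
-- (3,5), (3,6) and (4,6) are compared; together they link all four gaps. Each block is one diamond,
-- two moves made in either order.
diamonds₃₅ : ∀ {e₀ e₁ e₂ e₃ e₄ e₅ e₆ e₇ e₈ e₉ Q v} → ∃ λ y →
  Chain (e₀ ∷ e₁ ∷ e₂ ∷ e₃ ∷ e₄ ∷ e₅ ∷ e₆ ∷ e₇ ∷ e₈ ∷ e₉ ∷ Q) (bottom 5 6 ++ v) y (fourfold e₃ e₅)
diamonds₃₅ = _ ,
  (  walk (4 ∷ []) refl                                 ⨾ block 3 (5 ∷ []) refl refl refl
  ⨾ walk (4 ∷ 2 ∷ 6 ∷ []) refl                         ⨾ block 3 (5 ∷ []) refl refl refl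
  ⨾ walk (1 ∷ 2 ∷ 7 ∷ 6 ∷ 4 ∷ []) refl                 ⨾ block 3 (5 ∷ []) refl refl refl
  ⨾ walk (0 ∷ 1 ∷ 2 ∷ 8 ∷ 7 ∷ 6 ∷ 4 ∷ []) refl         ⨾ block 3 (5 ∷ []) refl refl refl
  ⨾ chain-refl )

diamonds₃₆ : ∀ {e₀ e₁ e₂ e₃ e₄ e₅ e₆ e₇ e₈ e₉ Q v} → ∃ λ y →
  Chain (e₀ ∷ e₁ ∷ e₂ ∷ e₃ ∷ e₄ ∷ e₅ ∷ e₆ ∷ e₇ ∷ e₈ ∷ e₉ ∷ Q) (bottom 5 6 ++ v) y (fourfold e₃ e₆)
diamonds₃₆ = _ ,
  (  walk (4 ∷ 5 ∷ []) refl                             ⨾ block 3 (6 ∷ []) refl refl refl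
  ⨾ walk (4 ∷ 5 ∷ 2 ∷ 7 ∷ []) refl                     ⨾ block 3 (6 ∷ []) refl refl refl
  ⨾ walk (4 ∷ 5 ∷ 1 ∷ 2 ∷ 8 ∷ 7 ∷ []) refl             ⨾ block 3 (6 ∷ []) refl refl refl
  ⨾ walk (4 ∷ 5 ∷ 0 ∷ 1 ∷ 2 ∷ 9 ∷ 8 ∷ 7 ∷ []) refl     ⨾ block 3 (6 ∷ []) refl refl refl
  ⨾ chain-refl )

diamonds₄₆ : ∀ {e₀ e₁ e₂ e₃ e₄ e₅ e₆ e₇ e₈ e₉ Q v} → ∃ λ y →
  Chain (e₀ ∷ e₁ ∷ e₂ ∷ e₃ ∷ e₄ ∷ e₅ ∷ e₆ ∷ e₇ ∷ e₈ ∷ e₉ ∷ Q) (bottom 5 6 ++ v) y (fourfold e₄ e₆)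
diamonds₄₆ = _ ,
  (  walk (4 ∷ 5 ∷ 3 ∷ []) refl                         ⨾ block 4 (6 ∷ []) refl refl refl
  ⨾ walk (5 ∷ 2 ∷ 3 ∷ 7 ∷ []) refl                     ⨾ block 4 (6 ∷ []) refl refl refl
  ⨾ walk (5 ∷ 1 ∷ 2 ∷ 3 ∷ 8 ∷ 7 ∷ []) refl             ⨾ block 4 (6 ∷ []) refl refl refl
  ⨾ walk (5 ∷ 0 ∷ 1 ∷ 2 ∷ 3 ∷ 9 ∷ 8 ∷ 7 ∷ []) refl     ⨾ block 4 (6 ∷ []) refl refl refl
  ⨾ chain-refl )

-- Rigidity: all inner gaps agree

Rigid : List ℕ → Set
Rigid E = ∀ P Q {e₀ e₁ e₂ e₃ e₄ e₅ e₆ e₇ e₈ e₉} →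
  E ≡ P ++ e₀ ∷ e₁ ∷ e₂ ∷ e₃ ∷ e₄ ∷ e₅ ∷ e₆ ∷ e₇ ∷ e₈ ∷ e₉ ∷ Q → e₃ ≡ e₆ × e₄ ≡ e₆ × e₅ ≡ e₆

-- The quadruples of equal gaps in successive windows overlap, so a single constant serves them all;
-- what lies beyond the last quadruple is the three gaps at the right end.
constant-core : ∀ {E} → Rigid E → ∀ P Q {e₀ e₁ e₂ e₃ e₄ e₅ e₆ e₇ e₈ e₉} →
  E ≡ P ++ e₀ ∷ e₁ ∷ e₂ ∷ e₃ ∷ e₄ ∷ e₅ ∷ e₆ ∷ e₇ ∷ e₈ ∷ e₉ ∷ Q →
  Σ ℕ λ n → ∃ λ d → ∃ λ q₃ → ∃ λ q₂ → ∃ λ q₁ →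
    e₃ ∷ e₄ ∷ e₅ ∷ e₆ ∷ e₇ ∷ e₈ ∷ e₉ ∷ Q ≡ replicate (4 + n) d ++ q₃ ∷ q₂ ∷ q₁ ∷ []
constant-core rigid P [] eq with rigid P [] eq
... | refl , refl , refl = 0 , _ , _ , _ , _ , refl
constant-core rigid P (q ∷ Q) {e₀} eq with rigid P (q ∷ Q) eq
... | refl , refl , refl
  -- The first gap joins the prefix, which moves the window one place to the right.
  with constant-core rigid (P ++ e₀ ∷ []) Q (trans eq (sym (++-assoc P (e₀ ∷ []) _)))
...   | n , d , q₃ , q₂ , q₁ , core with ∷-injectiveˡ core
...     | refl = suc n , d , q₃ , q₂ , q₁ , cong (d ∷_) core

replicate-+ : ∀ {A : Set} m n {x : A} → replicate (m + n) x ≡ replicate m x ++ replicate n x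
replicate-+ zero    n     = refl
replicate-+ (suc m) n {x} = cong (x ∷_) (replicate-+ m n)

word-split : ∀ p q (w : Word) → length w ≡ p + q →
             ∃ λ u → ∃ λ v → w ≡ u ++ v × length u ≡ p × length v ≡ q
word-split p q w eq =
  take p w , drop p w , sym (take++drop≡id p w) , len ,
  +-cancelˡ-≡ p _ _ (trans (cong (_+ length (drop p w)) (sym len))
    (trans (sym (length-++ (take p w))) (trans (cong length (take++drop≡id p w)) eq)))
  where
  len : length (take p w) ≡ p
  len = trans (length-take p w) (m≤n⇒m⊓n≡m (subst (p ≤_) (sym eq) (m≤m+n p q)))

ones-insert : ∀ u w v → ones (u ++ w ++ v) ≡ ones w + ones (u ++ v)
ones-insert u w v rewrite ones-++ u (w ++ v) | ones-++ w v | ones-++ u v =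
  solve 3 (λ u w v → u :+ (w :+ v) := w :+ (u :+ v)) refl (ones u) (ones w) (ones v)

length-insert : ∀ (u w v : Word) → length (u ++ w ++ v) ≡ length w + length (u ++ v)
length-insert u w v rewrite length-++ u {w ++ v} | length-++ w {v} | length-++ u {v} =
  solve 3 (λ u w v → u :+ (w :+ v) := w :+ (u :+ v)) refl (length u) (length w) (length v)

-- This is how the upper bound on the number of sums enters: a chain with more excess would produce
-- too many of them.
SmallExcess : List ℕ → ℕ → ℕ → Set
SmallExcess E a b = ∀ {e} → Chain E (bottom a b) (top a b) e → e ≤ 3

-- From here on `5 + h` elements are chosen and `14 + z` are not.
module _ (h z : ℕ) (E : List ℕ)
  (size  : suc (length E) ≡ 5 + h + (14 + z))
  (small : SmallExcess E (5 + h) (14 + z))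
  where

  -- Any chain extends down to `bottom` and up to `top` by stretches of excess 0, so the bound on
  -- full chains applies to it.
  small-anywhere : ∀ {x y e} → ones x ≡ 5 + h → length x ≡ 5 + h + (14 + z) → Chain E x y e → e ≤ 3
  small-anywhere {x} {y} {e} o l c =
    subst (_≤ 3) (+-identityʳ e)
      (small (⊑-chain (trans (length-bottom (5 + h) (14 + z)) (sym size)) (bottom-⊑ (5 + h) (14 + z) x o l)
            ⨾ c
            ⨾ ⊑-chain (trans ly (sym size))
                (top-⊒ (5 + h) (14 + z) y (trans (same-ones (Chain.same-shape c)) o) ly)))
    where
    ly : length y ≡ 5 + h + (14 + z)
    ly = trans (same-length (Chain.same-shape c)) l

  rigid : Rigid E
  rigid P Q {e₀} {e₁} {e₂} {e₃} {e₄} {e₅} {e₆} {e₇} {e₈} {e₉} eq =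
    e₃≡e₆ , fourfold≤3 e₄ e₆ (in-window λ _ → diamonds₄₆) ,
    trans (sym (fourfold≤3 e₃ e₅ (in-window λ _ → diamonds₃₅))) e₃≡e₆
    where
    W : List ℕ
    W = e₀ ∷ e₁ ∷ e₂ ∷ e₃ ∷ e₄ ∷ e₅ ∷ e₆ ∷ e₇ ∷ e₈ ∷ e₉ ∷ Q
    fits : length (bottom h (8 + z)) ≡ length P + length Q
    fits = +-cancelˡ-≡ 11 _ _ (trans (cong (_+_ 11) (length-bottom h (8 + z)))
      (trans (solve 2 (λ h z → con 11 :+ (h :+ (con 8 :+ z)) := con 5 :+ h :+ (con 14 :+ z)) refl h z)
      (trans (sym size) (trans (cong (λ l → suc (length l)) eq)
      (trans (cong suc (length-++ P)) (solve 2 (λ p q → con 1 :+ (p :+ (con 10 :+ q)) := con 11 :+ (p :+ q)) refl (length P) (length Q)))))))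
    in-window : ∀ {e} → (∀ v → ∃ λ y → Chain W (bottom 5 6 ++ v) y e) → e ≤ 3
    -- The other `h` ones and `8 + z` zeros are laid out as `bottom h (8 + z)`, cut so as to fit
    -- around the window.
    in-window {e} c with word-split (length P) (length Q) (bottom h (8 + z)) fits
    ... | u , v , w≡ , lu , lv = small-anywhere
      (trans (ones-insert u (bottom 5 6) v) (cong (_+_ 5) (trans (sym (cong ones w≡)) (ones-bottom h (8 + z)))))
      (trans (length-insert u (bottom 5 6) v) (trans (cong (_+_ 11) (trans (sym (cong length w≡)) (length-bottom h (8 + z))))
        (solve 2 (λ h z → con 11 :+ (h :+ (con 8 :+ z)) := con 5 :+ h :+ (con 14 :+ z)) refl h z)))
      (subst (λ E → Chain E (u ++ bottom 5 6 ++ v) (u ++ proj₁ (c v)) e) (sym eq) (chain-++ P u lu (proj₂ (c v))))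
    e₃≡e₆ : e₃ ≡ e₆
    e₃≡e₆ = fourfold≤3 e₃ e₆ (in-window λ _ → diamonds₃₆)

-- Three free gaps at either end, bounded by the corner chains

framed : ℕ → ℕ → ℕ → ℕ → ℕ → ℕ → ℕ → ℕ → List ℕ
framed p₁ p₂ p₃ n d q₃ q₂ q₁ = p₁ ∷ p₂ ∷ p₃ ∷ replicate n d ++ q₃ ∷ q₂ ∷ q₁ ∷ []

frame : ∀ m E → length E ≡ 18 + m → Rigid E →
  ∃ λ p₁ → ∃ λ p₂ → ∃ λ p₃ → ∃ λ d → ∃ λ q₃ → ∃ λ q₂ → ∃ λ q₁ → E ≡ framed p₁ p₂ p₃ (12 + m) d q₃ q₂ q₁
frame m (p₁ ∷ p₂ ∷ p₃ ∷ e₃ ∷ e₄ ∷ e₅ ∷ e₆ ∷ e₇ ∷ e₈ ∷ e₉ ∷ Q) len rigid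
  with constant-core rigid [] Q refl
... | n , d , q₃ , q₂ , q₁ , core =
  p₁ , p₂ , p₃ , d , q₃ , q₂ , q₁ ,
  cong (λ M → p₁ ∷ p₂ ∷ p₃ ∷ M)
    (trans core (cong (λ k → replicate k d ++ q₃ ∷ q₂ ∷ q₁ ∷ []) (+-cancelʳ-≡ 3 (4 + n) (12 + m)
      (begin
        4 + n + 3                                                ≡⟨ cong (_+ 3) (sym (length-replicate (4 + n))) ⟩
        length (replicate (4 + n) d) + 3                         ≡⟨ sym (length-++ (replicate (4 + n) d)) ⟩
        length (replicate (4 + n) d ++ q₃ ∷ q₂ ∷ q₁ ∷ [])       ≡⟨ cong length (sym core) ⟩
        7 + length Q                                             ≡⟨ cong (_∸ 3) len ⟩
        15 + m                                                   ≡⟨ solve 1 (λ m → con 15 :+ m := con 12 :+ m :+ con 3) refl m ⟩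
        12 + m + 3                                               ∎))))
  where open ≡-Reasoning

-- The two corner chains are joined in series, so their gains add up. Each uses a box of five ones
-- and seven zeros: the ones may serve twice, but the zeros may not, whence the 14.
corners : ∀ h z {p₁ p₂ p₃ d q₃ q₂ q₁} → let E = framed p₁ p₂ p₃ (12 + (h + z)) d q₃ q₂ q₁ in
  SmallExcess E (5 + h) (14 + z) → left-excess p₁ p₂ p₃ d + right-excess q₁ q₂ q₃ d ≤ 3
corners h z {p₁} {p₂} {p₃} {d} {q₃} {q₂} {q₁} small =
  small-anywhere h z E size small
    (cong (_+_ 5) (ones-bottom h (7 + z)))
    (trans (cong (_+_ 12) (length-bottom h (7 + z)))
      (solve 2 (λ h z → con 12 :+ (h :+ (con 7 :+ z)) := con 5 :+ h :+ (con 14 :+ z)) refl h z))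
    (left ⨾ middle ⨾ right)
  where
  E tail : List ℕ
  E = framed p₁ p₂ p₃ (12 + (h + z)) d q₃ q₂ q₁
  tail = q₃ ∷ q₂ ∷ q₁ ∷ []
  size : suc (length E) ≡ 5 + h + (14 + z)
  size = trans (cong (_+_ 4) (trans (length-++ (replicate (12 + (h + z)) d)) (cong (_+ 3) (length-replicate (12 + (h + z))))))
    (solve 2 (λ h z → con 4 :+ (con 12 :+ (h :+ z) :+ con 3) := con 5 :+ h :+ (con 14 :+ z)) refl h z)
  pad w₂ w₁ : Word
  pad = top h z
  w₂ = pad ++ bottom 5 7
  w₁ = top h (7 + z) ++ bottom 5 7
  suc-injective⁷ : ∀ {m n} → 7 + m ≡ 7 + n → m ≡ n
  suc-injective⁷ = +-cancelˡ-≡ 7 _ _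
  shift-size : 7 + (5 + h + (7 + z)) ≡ 5 + h + (14 + z)
  shift-size = solve 2 (λ h z → con 7 :+ (con 5 :+ h :+ (con 7 :+ z)) := con 5 :+ h :+ (con 14 :+ z)) refl h z
  left : Chain E (bottom 5 7 ++ bottom h (7 + z)) (top 5 7 ++ bottom h (7 + z)) (left-excess p₁ p₂ p₃ d)
  left = left-corner
  middle : Chain E (top 5 7 ++ bottom h (7 + z)) w₁ 0
  -- The seven leading zeros are already final; behind them stands `bottom (5 + h) (7 + z)`, which
  -- rises to `w₂` without claimed gain.
  middle = chain-++ (p₁ ∷ p₂ ∷ p₃ ∷ replicate 4 d) (replicate 7 false) refl
    (⊑-chain
      (trans (length-bottom (5 + h) (7 + z)) (suc-injective⁷ (trans shift-size (sym size))))
      (bottom-⊑ (5 + h) (7 + z) w₂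
        (trans (ones-++ pad (bottom 5 7)) (trans (cong (_+ 5) (ones-top h z)) (+-comm h 5)))
        (trans (length-++ pad) (trans (cong (_+ 12) (length-top h z))
          (solve 2 (λ h z → h :+ z :+ con 12 := con 5 :+ h :+ (con 7 :+ z)) refl h z)))))
  splice : replicate (4 + (h + z)) d ++ replicate 8 d ++ tail ≡ replicate (12 + (h + z)) d ++ tail
  splice = trans (sym (++-assoc (replicate (4 + (h + z)) d) (replicate 8 d) tail))
    (cong (_++ tail) (trans (sym (replicate-+ (4 + (h + z)) 8))
      (cong (λ n → replicate n d) (+-comm (4 + (h + z)) 8))))
  right : Chain E w₁ (top h (7 + z) ++ top 5 7) (right-excess q₁ q₂ q₃ d)
  right = subst (λ E → Chain E w₁ (top h (7 + z) ++ top 5 7) (right-excess q₁ q₂ q₃ d))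
    (cong (λ M → p₁ ∷ p₂ ∷ p₃ ∷ M) splice)
    (chain-++ (p₁ ∷ p₂ ∷ p₃ ∷ replicate (4 + (h + z)) d) (top h (7 + z))
      (trans (length-top h (7 + z)) (trans (solve 2 (λ h z → h :+ (con 7 :+ z) := con 7 :+ (h :+ z)) refl h z)
        (cong (_+_ 3) (sym (length-replicate (4 + (h + z)))))))
      (right-corner {d} {q₁} {q₂} {q₃}))

below-cap : ∀ m {f d} → excess m (suc f) (suc d) < m → suc f ≡ suc (excess m (suc f) (suc d)) * suc d
below-cap m {f} {d} = excess-multiple m (suc f) (suc d)

record Corner (d p₁ p₂ p₃ bound : ℕ) : Set where
  field
    α₁ α₂ α₃ : ℕ
    multiple₁ : suc p₁ ≡ suc α₁ * suc d
    multiple₂ : suc p₂ ≡ suc α₂ * suc d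
    multiple₃ : suc p₃ ≡ suc α₃ * suc d
    total     : α₃ * 3 + (α₂ * 2 + α₁) ≡ bound

*2≤3⇒<2 : ∀ a → a * 2 ≤ 3 → a < 2
*2≤3⇒<2 zero          _ = s≤s z≤n
*2≤3⇒<2 (suc zero)    _ = s≤s (s≤s z≤n)
*2≤3⇒<2 (suc (suc a)) (s≤s (s≤s (s≤s ())))

-- The sum of the excesses, weighted 3, 2 and 1, is at most 3, so each stays below its cap and
-- `excess-multiple` applies to it.
corner : ∀ d p₁ p₂ p₃ {e} → left-excess p₁ p₂ p₃ d ≡ e → e ≤ 3 → Corner d p₁ p₂ p₃ e
corner d p₁ p₂ p₃ refl le = record
  { α₁ = x₁ ; α₂ = x₂ ; α₃ = x₃
  ; multiple₁ = below-cap 4 (s≤s (≤-trans (m≤n+m x₁ (x₃ * 3 + x₂ * 2)) (≤-trans (≤-reflexive (+-assoc (x₃ * 3) (x₂ * 2) x₁)) le′)))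
  ; multiple₂ = below-cap 2 (*2≤3⇒<2 x₂ (≤-trans (m≤m+n (x₂ * 2) x₁) (≤-trans (m≤n+m _ (x₃ * 3)) le′)))
  ; multiple₃ = below-cap 2 (*2≤3⇒<2 x₃ (≤-trans (*-monoʳ-≤ x₃ {2} {3} (s≤s (s≤s z≤n))) (≤-trans (m≤m+n (x₃ * 3) _) le′)))
  ; total     = sym rearrange
  }
  where
  x₁ x₂ x₃ : ℕ
  x₁ = excess 4 (suc p₁) (suc d)
  x₂ = excess 2 (suc p₂) (suc d)
  x₃ = excess 2 (suc p₃) (suc d)
  rearrange : left-excess p₁ p₂ p₃ d ≡ x₃ * 3 + (x₂ * 2 + x₁)
  rearrange = solve 3 (λ a b c → c :+ (b :+ (a :+ (c :+ (b :+ (c :+ con 0))))) := c :* con 3 :+ (b :* con 2 :+ a)) refl x₁ x₂ x₃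
  le′ : x₃ * 3 + (x₂ * 2 + x₁) ≤ 3
  le′ = subst (_≤ 3) rearrange le

right≡left : ∀ q₁ q₂ q₃ d → right-excess q₁ q₂ q₃ d ≡ left-excess q₁ q₂ q₃ d
right≡left q₁ q₂ q₃ d =
  solve 3 (λ a b c → c :+ (b :+ (c :+ (a :+ (b :+ (c :+ con 0))))) := c :+ (b :+ (a :+ (c :+ (b :+ (c :+ con 0)))))) refl
    (excess 4 (suc q₁) (suc d)) (excess 2 (suc q₂) (suc d)) (excess 2 (suc q₃) (suc d))

unit-gap : ∀ {p} α → suc p ≡ suc α * 1 → p ≡ α
unit-gap α eq = suc-injective (trans eq (*-identityʳ (suc α)))

-- A gap of 0 is a difference of 1, so the multipliers are the differences themselves and each `α`
-- is the corresponding gap.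
corner-unit : ∀ {p₁ p₂ p₃ e} → Corner 0 p₁ p₂ p₃ e → p₃ * 3 + (p₂ * 2 + p₁) ≡ e
corner-unit c = trans (cong₂ _+_ (cong (_* 3) (unit-gap α₃ multiple₃))
                        (cong₂ _+_ (cong (_* 2) (unit-gap α₂ multiple₂)) (unit-gap α₁ multiple₁))) total
  where open Corner c

-- Subset sums and the restricted sumset

data SubsetSum : ℕ → List ℕ → ℕ → Set where
  none : SubsetSum 0 [] 0
  pick : ∀ {h b B s} → SubsetSum h B s → SubsetSum (suc h) (b ∷ B) (b + s)
  omit : ∀ {h b B s} → SubsetSum h B s → SubsetSum h (b ∷ B) s

empty-sum : ∀ B → SubsetSum 0 B 0
empty-sum []      = none
empty-sum (b ∷ B) = omit (empty-sum B)

-- The given list comes in any order, whereas gaps describe the sorted one; this passes between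
-- them.
subset-sum-↭ : ∀ {h s B C} → B ↭ C → SubsetSum h B s → SubsetSum h C s
subset-sum-↭ refl         p = p
subset-sum-↭ (prep b r)   (pick p) = pick (subset-sum-↭ r p)
subset-sum-↭ (prep b r)   (omit p) = omit (subset-sum-↭ r p)
subset-sum-↭ (swap {ys = C} b c r) (pick (pick {s = s} p)) =
  subst (SubsetSum _ (c ∷ b ∷ C)) (solve 3 (λ b c s → c :+ (b :+ s) := b :+ (c :+ s)) refl b c s)
    (pick (pick (subset-sum-↭ r p)))
subset-sum-↭ (swap b c r) (pick (omit p)) = omit (pick (subset-sum-↭ r p))
subset-sum-↭ (swap b c r) (omit (pick p)) = pick (omit (subset-sum-↭ r p))
subset-sum-↭ (swap b c r) (omit (omit p)) = omit (omit (subset-sum-↭ r p))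
subset-sum-↭ (Perm.trans r q) p = subset-sum-↭ q (subset-sum-↭ r p)

chosen⇒subset-sum : ∀ h B {L} → L ∈ choose h (map +_ B) → ∃ λ s → sumℤ L ≡ + s × SubsetSum h B s
chosen⇒subset-sum zero    B       (here refl) = 0 , refl , empty-sum B
chosen⇒subset-sum (suc h) (b ∷ B) L∈ with ∈-++⁻ (map (+ b ∷_) (choose h (map +_ B))) L∈
... | inj₁ with-b with ∈-map⁻ _ with-b
...   | L′ , L′∈ , refl with chosen⇒subset-sum h B L′∈
...     | s , eq , p = b + s , cong (ℤ._+_ (+ b)) eq , pick p
chosen⇒subset-sum (suc h) (b ∷ B) L∈ | inj₂ without-b with chosen⇒subset-sum (suc h) B without-b
... | s , eq , p = s , eq , omit p

subset-sum⇒chosen : ∀ {h B s} → SubsetSum h B s → ∃ λ L → L ∈ choose h (map +_ B) × sumℤ L ≡ + s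
subset-sum⇒chosen none = [] , here refl , refl
subset-sum⇒chosen (pick {b = b} p) with subset-sum⇒chosen p
... | L , L∈ , eq = + b ∷ L , ∈-++⁺ˡ (∈-map⁺ (+ b ∷_) L∈) , cong (ℤ._+_ (+ b)) eq
-- `choose zero` does not inspect the list, so omitting an element is a separate case here.
subset-sum⇒chosen {zero}  (omit p) with subset-sum⇒chosen p
subset-sum⇒chosen {zero}  (omit p) | L , here refl , eq = L , here refl , eq
subset-sum⇒chosen {suc h} {b ∷ B} (omit p) with subset-sum⇒chosen p
... | L , L∈ , eq = L , ∈-++⁺ʳ (map (+ b ∷_) (choose h (map +_ B))) L∈ , eq

sumset⁺ : ∀ {h B s} → SubsetSum h B s → + s ∈ restrictedSumset h (map +_ B)
sumset⁺ {h} {B} p with subset-sum⇒chosen p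
... | L , L∈ , eq = ∈-deduplicate⁺ ℤ._≟_ (subst (_∈ map sumℤ (choose h (map +_ B))) eq (∈-map⁺ sumℤ L∈))

sumset⁻ : ∀ {h B x} → x ∈ restrictedSumset h (map +_ B) → ∃ λ s → x ≡ + s × SubsetSum h B s
sumset⁻ {h} {B} x∈ with ∈-map⁻ sumℤ (∈-deduplicate⁻ ℤ._≟_ _ x∈)
... | L , L∈ , refl = chosen⇒subset-sum h B L∈

-- Gap lists as an encoding of finite sets

elements : ℕ → List ℕ → List ℕ
elements a []      = a ∷ []
elements a (e ∷ E) = a ∷ elements (suc (e + a)) E

-- The starting point `a` is contained in every chosen element, hence the term `a * ones w`; for
-- `a = 0` the sum is `value E w`.
word-sum : ∀ a E w → length w ≡ suc (length E) → SubsetSum (ones w) (elements a E) (a * ones w + value E w)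
word-sum a []      (true ∷ [])  refl = subst (SubsetSum 1 (a ∷ [])) (solve 1 (λ a → a :+ con 0 := a :* con 1 :+ con 0) refl a) (pick none)
word-sum a []      (false ∷ []) refl = subst (SubsetSum 0 (a ∷ [])) (solve 1 (λ a → con 0 := a :* con 0 :+ con 0) refl a) (omit none)
word-sum a (e ∷ E) (true ∷ w) len =
  subst (SubsetSum _ _)
    (solve 5 (λ a e o t s → a :+ ((con 1 :+ (e :+ a)) :* o :+ (t :+ s)) := a :* (con 1 :+ o) :+ (o :+ t :+ (e :* o :+ s))) refl
      a e (ones w) (weight w) (slack E w))
    (pick (word-sum (suc (e + a)) E w (suc-injective len)))
word-sum a (e ∷ E) (false ∷ w) len =
  subst (SubsetSum _ _)
    (solve 5 (λ a e o t s → (con 1 :+ (e :+ a)) :* o :+ (t :+ s) := a :* o :+ (o :+ t :+ (e :* o :+ s))) refl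
      a e (ones w) (weight w) (slack E w))
    (omit (word-sum (suc (e + a)) E w (suc-injective len)))

sum-word : ∀ a E {h s} → SubsetSum h (elements a E) s →
           ∃ λ w → ones w ≡ h × length w ≡ suc (length E) × s ≡ a * h + value E w
sum-word a [] (pick none) = true ∷ [] , refl , refl , solve 1 (λ a → a :+ con 0 := a :* con 1 :+ con 0) refl a
sum-word a [] (omit none) = false ∷ [] , refl , refl , solve 1 (λ a → con 0 := a :* con 0 :+ con 0) refl a
sum-word a (e ∷ E) (pick p) with sum-word (suc (e + a)) E p
... | w , refl , len , refl = true ∷ w , refl , cong suc len ,
  solve 5 (λ a e o t s → a :+ ((con 1 :+ (e :+ a)) :* o :+ (t :+ s)) := a :* (con 1 :+ o) :+ (o :+ t :+ (e :* o :+ s))) refl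
      a e (ones w) (weight w) (slack E w)
sum-word a (e ∷ E) (omit p) with sum-word (suc (e + a)) E p
... | w , refl , len , refl = false ∷ w , refl , cong suc len ,
  solve 5 (λ a e o t s → (con 1 :+ (e :+ a)) :* o :+ (t :+ s) := a :* o :+ (o :+ t :+ (e :* o :+ s))) refl
      a e (ones w) (weight w) (slack E w)

gaps-of : ∀ b B → Linked _≤_ (b ∷ B) → Unique (b ∷ B) → ∃ λ E → b ∷ B ≡ elements b E
gaps-of b []      _ _ = [] , refl
gaps-of b (c ∷ B) (b≤c ∷ sorted) ((b≢c ∷ _) ∷ unique) with gaps-of c B sorted unique
... | E , eq = c ∸ suc b ∷ E , cong (b ∷_) (trans eq (cong (λ x → elements x E) (sym step)))
  where
  step : suc (c ∸ suc b + b) ≡ c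
  step = trans (sym (+-suc (c ∸ suc b) b)) (m∸n+n≡m (≤∧≢⇒< b≤c b≢c))

-- Sort `B`; its entries are natural numbers and 0 is among them, so the sorted list begins with 0.
gap-encoding : ∀ B → 0 ∈ B → Unique B → ∃ λ E → B ↭ elements 0 E
gap-encoding B 0∈B unique with sort B | sort-↭ B | sort-↗ B
... | [] | r | _ with () ← ∈-resp-↭ (↭-sym r) 0∈B
... | b ∷ bs | r | sorted with gaps-of b bs sorted (Permutation.Unique-resp-↭ (setoid ℕ) (↭⇒↭ₛ (↭-sym r)) unique)
...   | E , eq = E , subst (B ↭_) (trans eq (cong (λ x → elements x E) b≡0)) (↭-sym r)
  where
  b≡0 : b ≡ 0
  b≡0 with ∈-resp-↭ (↭-sym r) 0∈B | Sorted⇒AllPairs ≤-totalOrder sorted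
  ... | here 0≡b  | _       = sym 0≡b
  ... | there 0∈bs | b≤ ∷ _ = n≤0⇒n≡0 (All.lookup b≤ 0∈bs)

naturals : ∀ A → (∀ a → a ∈ A → + 0 ℤ.≤ a) → ∃ λ B → A ≡ map +_ B
naturals []      _   = [] , refl
naturals (a ∷ A) pos with naturals A (λ x x∈ → pos x (there x∈)) | a | pos a (here refl)
... | B , eq | + n | _ = n ∷ B , cong (+ n ∷_) eq

-- Lower and upper bounds for the number of sums

unique-⊆⇒length≤ : ∀ {X : Set} {xs ys : List X} → Unique xs → (∀ {x} → x ∈ xs → x ∈ ys) → length xs ≤ length ys
unique-⊆⇒length≤ [] _ = z≤n
unique-⊆⇒length≤ {xs = x ∷ xs} (x∉ ∷ u) sub with ∈-∃++ (sub (here refl))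
... | us , vs , refl = begin
  suc (length xs)              ≤⟨ s≤s (unique-⊆⇒length≤ u still) ⟩
  suc (length (us ++ vs))      ≡⟨ cong suc (length-++ us) ⟩
  suc (length us + length vs)  ≡⟨ sym (+-suc (length us) (length vs)) ⟩
  length us + suc (length vs)  ≡⟨ sym (length-++ us) ⟩
  length (us ++ x ∷ vs)        ∎
  where
  open ≤-Reasoning
  still : ∀ {y} → y ∈ xs → y ∈ us ++ vs
  still y∈ with ∈-++⁻ us (sub (there y∈))
  ... | inj₁ p         = ∈-++⁺ˡ p
  ... | inj₂ (here eq) = ⊥-elim (All.lookup x∉ y∈ (sym eq))
  ... | inj₂ (there p) = ∈-++⁺ʳ us p

path-≤ : ∀ {P n s t} → Path P n s t → s ≤ t
path-≤ [ _ ]           = ≤-refl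
path-≤ (_ ∷⟨ s<t ⟩ p) = ≤-trans (<⇒≤ s<t) (path-≤ p)

path-values : ∀ {P n s t} → Path P n s t → ∃ λ L →
  length L ≡ suc n × Unique L × All P L × All (s ≤_) L
path-values {s = s} [ p ] = s ∷ [] , refl , [] ∷ [] , p ∷ [] , ≤-refl ∷ []
path-values {s = s} (p ∷⟨ s<t ⟩ q) with path-values q
... | L , len , u , P-L , t≤L = s ∷ L , cong suc len ,
  All.map (λ t≤x → <⇒≢ (<-≤-trans s<t t≤x)) t≤L ∷ u , p ∷ P-L ,
  ≤-refl ∷ All.map (λ t≤x → ≤-trans (<⇒≤ s<t) t≤x) t≤L

reach⇒subset-sum : ∀ {E a b s} → a + b ≡ suc (length E) → Reach E (bottom a b) s → SubsetSum a (elements 0 E) s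
reach⇒subset-sum {E} {a} {b} size (w , shape o l , refl) =
  subst (λ h → SubsetSum h (elements 0 E) (value E w)) (trans o (ones-bottom a b))
    (word-sum 0 E w (trans l (trans (length-bottom a b) size)))

-- By `weight-top` such a chain has `a * b + e` steps, and its strictly increasing values are
-- distinct sums.
chain⇒sumset≥ : ∀ {E a b B e} → B ↭ elements 0 E → a + b ≡ suc (length E) →
                 Chain E (bottom a b) (top a b) e → suc (a * b + e) ≤ length (restrictedSumset a (map +_ B))
chain⇒sumset≥ {E} {a} {b} {B} {e} B↭ size (chain {n} path count _) with path-values path
... | L , len , unique , reached , _ = begin
  suc (a * b + e)                        ≡⟨ cong suc (sym n≡) ⟩
  suc n                                  ≡⟨ sym len ⟩
  length L                               ≡⟨ sym (length-map +_ L) ⟩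
  length (map +_ L)                      ≤⟨ unique-⊆⇒length≤ (Unique.map⁺ ℤ.+-injective unique) sums ⟩
  length (restrictedSumset a (map +_ B)) ∎
  where
  open ≤-Reasoning
  n≡ : n ≡ a * b + e
  n≡ = +-cancelʳ-≡ (weight (bottom a b)) n (a * b + e)
    (trans count (trans (cong (_+ e) (weight-top a b))
      (solve 3 (λ p w e → p :+ w :+ e := p :+ e :+ w) refl (a * b) (weight (bottom a b)) e)))
  sums : ∀ {x} → x ∈ map +_ L → x ∈ restrictedSumset a (map +_ B)
  sums x∈ with ∈-map⁻ +_ x∈
  ... | s , s∈ , refl = sumset⁺ (subset-sum-↭ (↭-sym B↭) (reach⇒subset-sum {E} {a} {b} size (All.lookup reached s∈)))

-- Every word lies between `bottom` and `top` in the order of moves, hence so does its value.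
sumset≤range : ∀ {E a b B n} → B ↭ elements 0 E → a + b ≡ suc (length E) →
               value E (top a b) ≡ value E (bottom a b) + n →
               length (restrictedSumset a (map +_ B)) ≤ suc n
sumset≤range {E} {a} {b} {B} {n} B↭ size range = begin
  length (restrictedSumset a (map +_ B))     ≤⟨ unique-⊆⇒length≤ (deduplicate-! ℤ._≟_ _) inside ⟩
  length (map f (upTo (suc n)))              ≡⟨ length-map f (upTo (suc n)) ⟩
  length (upTo (suc n))                      ≡⟨ length-upTo (suc n) ⟩
  suc n                                      ∎
  where
  open ≤-Reasoning
  low : ℕ
  low = value E (bottom a b)
  f : ℕ → ℤ
  f i = + (low + i)
  inside : ∀ {x} → x ∈ restrictedSumset a (map +_ B) → x ∈ map f (upTo (suc n))
  inside x∈ with sumset⁻ {a} {B} x∈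
  ... | s , refl , p with sum-word 0 E (subset-sum-↭ B↭ p)
  ...   | w , o , len , refl =
    subst (λ s → + s ∈ map f (upTo (suc n))) (m+[n∸m]≡n low≤)
      (∈-map⁺ f (∈-upTo⁺ (s≤s (m≤n+o⇒m∸n≤o (value E w) low (subst (value E w ≤_) range ≤high)))))
    where
    lw : length w ≡ a + b
    lw = trans len (sym size)
    low≤ : low ≤ value E w
    low≤ = path-≤ (Chain.path (⊑-chain {E} (trans (length-bottom a b) size) (bottom-⊑ a b w o lw)))
    ≤high : value E w ≤ value E (top a b)
    ≤high = path-≤ (Chain.path (⊑-chain {E} len (top-⊒ a b w o lw)))

slack-skip : ∀ {T} n u v → length u ≡ n → slack (replicate n 0 ++ T) (u ++ v) ≡ slack T v
slack-skip zero    []      v _  = refl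
slack-skip (suc n) (_ ∷ u) v eq = slack-skip n u v (suc-injective eq)

corner-weight : ℕ → ℕ → ℕ → ℕ
corner-weight p₁ p₂ p₃ = p₃ * 3 + (p₂ * 2 + p₁)

-- With inner gaps 0, passing from least to greatest carries `i` elements over the `i`-th gap from
-- either end, for `i` up to 3; this adds the corner weights to the `a * b` unit moves.
value-range : ∀ h z p₁ p₂ p₃ q₃ q₂ q₁ → let E = framed p₁ p₂ p₃ (12 + (h + z)) 0 q₃ q₂ q₁ in
  value E (top (5 + h) (14 + z)) ≡ value E (bottom (5 + h) (14 + z)) +
    ((5 + h) * (14 + z) + (corner-weight p₁ p₂ p₃ + corner-weight q₁ q₂ q₃))
value-range h z p₁ p₂ p₃ q₃ q₂ q₁ = begin
  weight (top a b) + slack E (top a b)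
    ≡⟨ cong₂ _+_ (weight-top a b) slack-top ⟩
  a * b + weight (bottom a b) + (p₁ * (5 + h) + (p₂ * (5 + h) + (p₃ * (5 + h) + (q₃ * 3 + (q₂ * 2 + (q₁ * 1 + 0))))))
    ≡⟨ solve 9 (λ x w h p₁ p₂ p₃ q₃ q₂ q₁ →
         x :+ w :+ (p₁ :* (con 5 :+ h) :+ (p₂ :* (con 5 :+ h) :+ (p₃ :* (con 5 :+ h) :+ (q₃ :* con 3 :+ (q₂ :* con 2 :+ (q₁ :* con 1 :+ con 0))))))
         := w :+ (p₁ :* (con 4 :+ h) :+ (p₂ :* (con 3 :+ h) :+ (p₃ :* (con 2 :+ h) :+ con 0)))
            :+ (x :+ (p₃ :* con 3 :+ (p₂ :* con 2 :+ p₁) :+ (q₃ :* con 3 :+ (q₂ :* con 2 :+ q₁)))))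
         refl (a * b) (weight (bottom a b)) h p₁ p₂ p₃ q₃ q₂ q₁ ⟩
  weight (bottom a b) + (p₁ * (4 + h) + (p₂ * (3 + h) + (p₃ * (2 + h) + 0))) + total
    ≡⟨ cong (λ s → weight (bottom a b) + s + total) (sym slack-bottom) ⟩
  weight (bottom a b) + slack E (bottom a b) + total ∎
  where
  open ≡-Reasoning
  a b total : ℕ
  a = 5 + h
  b = 14 + z
  total = a * b + (corner-weight p₁ p₂ p₃ + corner-weight q₁ q₂ q₃)
  tail E : List ℕ
  tail = q₃ ∷ q₂ ∷ q₁ ∷ []
  E = framed p₁ p₂ p₃ (12 + (h + z)) 0 q₃ q₂ q₁
  slack-top : slack E (top a b) ≡ p₁ * (5 + h) + (p₂ * (5 + h) + (p₃ * (5 + h) + (q₃ * 3 + (q₂ * 2 + (q₁ * 1 + 0)))))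
  slack-top rewrite ones-top (5 + h) (13 + z) =
    cong (λ s → p₁ * (5 + h) + (p₂ * (5 + h) + (p₃ * (5 + h) + s)))
      (trans (cong (slack (replicate (12 + (h + z)) 0 ++ tail)) split)
        (slack-skip {tail} (12 + (h + z)) (top (1 + h) (11 + z)) (replicate 4 true)
          (trans (length-top (1 + h) (11 + z)) (solve 2 (λ h z → con 1 :+ h :+ (con 11 :+ z) := con 12 :+ (h :+ z)) refl h z))))
    where
    split : top (5 + h) (11 + z) ≡ top (1 + h) (11 + z) ++ replicate 4 true
    split = trans (cong (replicate (11 + z) false ++_) (trans (cong (λ n → replicate n true) (+-comm 4 (1 + h))) (replicate-+ (1 + h) 4)))
                  (sym (++-assoc (replicate (11 + z) false) (replicate (1 + h) true) (replicate 4 true)))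
  slack-bottom : slack E (bottom a b) ≡ p₁ * (4 + h) + (p₂ * (3 + h) + (p₃ * (2 + h) + 0))
  slack-bottom rewrite ones-bottom h (14 + z) =
    cong (λ s → p₁ * (4 + h) + (p₂ * (3 + h) + (p₃ * (2 + h) + s)))
      (trans (cong (slack (replicate (12 + (h + z)) 0 ++ tail)) split)
        (trans (slack-skip {tail} (12 + (h + z)) (bottom (2 + h) (10 + z)) (replicate 4 false)
          (trans (length-bottom (2 + h) (10 + z)) (solve 2 (λ h z → con 2 :+ h :+ (con 10 :+ z) := con 12 :+ (h :+ z)) refl h z)))
          (solve 3 (λ a b c → a :* con 0 :+ (b :* con 0 :+ (c :* con 0 :+ con 0)) := con 0) refl q₃ q₂ q₁)))
    where
    split : bottom (2 + h) (14 + z) ≡ bottom (2 + h) (10 + z) ++ replicate 4 false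
    split = trans (cong (replicate (2 + h) true ++_) (trans (cong (λ n → replicate n false) (+-comm 4 (10 + z))) (replicate-+ (10 + z) 4)))
                  (sym (++-assoc (replicate (2 + h) true) (replicate (10 + z) false) (replicate 4 false)))

-- Divisibility

elements-∣ : ∀ {d a} E → d ∣ a → All (λ e → d ∣ suc e) E → All (d ∣_) (elements a E)
elements-∣ []      d∣a []           = d∣a ∷ []
elements-∣ {d} {a} (e ∷ E) d∣a (d∣e ∷ d∣E) = d∣a ∷ elements-∣ E (∣m∣n⇒∣m+n d∣e d∣a) d∣E

∣gcdList : ∀ {d} B → (∀ {b} → b ∈ B → d ∣ b) → d ∣ gcdList (map +_ B)
∣gcdList []      _   = _ ∣0
∣gcdList (b ∷ B) d∣B = gcd-greatest (d∣B (here refl)) (∣gcdList B (λ b∈ → d∣B (there b∈)))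

-- Complements in an interval and the ten exceptional triples

range : ℕ → ℕ → List ℕ
range a zero    = []
range a (suc n) = a ∷ range (suc a) n

∈-range⁺ : ∀ {a} n {m} → a ≤ m → m < n + a → m ∈ range a n
∈-range⁺ zero a≤m m<a = ⊥-elim (<⇒≱ m<a a≤m)
∈-range⁺ {a} (suc n) {m} a≤m m< with m≤n⇒m<n∨m≡n a≤m
... | inj₁ a<m  = there (∈-range⁺ n a<m (subst (m <_) (sym (+-suc n a)) m<))
... | inj₂ refl = here refl

∈-range⁻ : ∀ {a} n {m} → m ∈ range a n → a ≤ m × m < n + a
∈-range⁻ (suc n) (here refl) = ≤-refl , s≤s (m≤n+m _ n)
∈-range⁻ {a} (suc n) {m} (there m∈) with ∈-range⁻ n m∈
... | a<m , m< = <⇒≤ a<m , subst (m <_) (+-suc n a) m<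

-- The complement of elements a E in [a, limit a E t], whose last t points lie above the set.
holes : ℕ → List ℕ → ℕ → List ℕ
holes a []      t = range (suc a) t
holes a (e ∷ E) t = range (suc a) e ++ holes (suc (e + a)) E t

limit : ℕ → List ℕ → ℕ → ℕ
limit a []      t = t + a
limit a (e ∷ E) t = limit (suc (e + a)) E t

holes-above : ∀ a E t {m} → m ∈ holes a E t → a < m
holes-above a []      t m∈ = proj₁ (∈-range⁻ t m∈)
holes-above a (e ∷ E) t m∈ with ∈-++⁻ (range (suc a) e) m∈
... | inj₁ p = proj₁ (∈-range⁻ e p)
... | inj₂ p = ≤-trans (s≤s (≤-trans (m≤n+m a e) (n≤1+n _))) (holes-above (suc (e + a)) E t p)

limit-above : ∀ a E t → a ≤ limit a E t
limit-above a []      t = m≤n+m a t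
limit-above a (e ∷ E) t = ≤-trans (≤-trans (m≤n+m a e) (n≤1+n _)) (limit-above (suc (e + a)) E t)

elements⁻ : ∀ a E t {m} → m ∈ elements a E → a ≤ m × m ≤ limit a E t × m ∉ holes a E t
elements⁻ a []      t (here refl) = ≤-refl , limit-above a [] t , λ p → <-irrefl refl (holes-above a [] t p)
elements⁻ a (e ∷ E) t (here refl) = ≤-refl , limit-above a (e ∷ E) t , λ p → <-irrefl refl (holes-above a (e ∷ E) t p)
elements⁻ a (e ∷ E) t {m} (there m∈) with elements⁻ (suc (e + a)) E t m∈
... | above , below , m∉ = ≤-trans (≤-trans (m≤n+m a e) (n≤1+n _)) above , below , λ p → outside (∈-++⁻ (range (suc a) e) p)
  where
  outside : m ∈ range (suc a) e ⊎ m ∈ holes (suc (e + a)) E t → ⊥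
  outside (inj₁ p) = <⇒≱ (subst (m <_) (+-suc e a) (proj₂ (∈-range⁻ e p))) above
  outside (inj₂ p) = m∉ p

elements⁺ : ∀ a E t {m} → a ≤ m → m ≤ limit a E t → m ∉ holes a E t → m ∈ elements a E
elements⁺ a E t {m} a≤m m≤ m∉ with m≤n⇒m<n∨m≡n a≤m
elements⁺ a []      t a≤m m≤ m∉ | inj₂ refl = here refl
elements⁺ a (e ∷ E) t a≤m m≤ m∉ | inj₂ refl = here refl
elements⁺ a []      t {m} a≤m m≤ m∉ | inj₁ a<m =
  ⊥-elim (m∉ (∈-range⁺ t a<m (subst (m <_) (sym (+-suc t a)) (s≤s m≤))))
elements⁺ a (e ∷ E) t {m} a≤m m≤ m∉ | inj₁ a<m with <-≤-connex m (suc (e + a))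
... | inj₁ m<  = ⊥-elim (m∉ (∈-++⁺ˡ (∈-range⁺ e a<m (subst (m <_) (sym (+-suc e a)) m<))))
... | inj₂ ≤m = there (elements⁺ (suc (e + a)) E t ≤m m≤ (λ p → m∉ (∈-++⁺ʳ (range (suc a) e) p)))

interval-minus : ∀ {B k x y z} E t → B ↭ elements 0 E → limit 0 E t ≡ k + 2 →
  holes 0 E t ≡ x ∷ y ∷ z ∷ [] → IsIntervalMinus (map +_ B) k (+ x , + y , + z)
interval-minus {B} {k} {x} {y} {z} E t B↭ lim≡ holes≡ n = to , from
  where
  Outside : ℤ → Set
  Outside n = + 0 ℤ.≤ n × n ℤ.≤ + (k + 2) × ¬ n ≡ + x × ¬ n ≡ + y × ¬ n ≡ + z
  to : n ∈ map +_ B → Outside n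
  to n∈ with ∈-map⁻ +_ n∈
  ... | m , m∈ , refl with elements⁻ 0 E t (∈-resp-↭ B↭ m∈)
  ...   | _ , m≤ , m∉ rewrite holes≡ =
    ℤ.+≤+ z≤n , ℤ.+≤+ (subst (m ≤_) lim≡ m≤) ,
    (λ { refl → m∉ (here refl) }) , (λ { refl → m∉ (there (here refl)) }) , (λ { refl → m∉ (there (there (here refl))) })
  from : Outside n → n ∈ map +_ B
  from (ℤ.+≤+ {n = m} _ , ℤ.+≤+ m≤ , ≢x , ≢y , ≢z) =
    ∈-map⁺ +_ (∈-resp-↭ (↭-sym B↭) (elements⁺ 0 E t z≤n (subst (m ≤_) (sym lim≡) m≤) (subst (m ∉_) (sym holes≡) m∉)))
    where
    m∉ : m ∉ x ∷ y ∷ z ∷ []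
    m∉ (here refl)                 = ≢x refl
    m∉ (there (here refl))         = ≢y refl
    m∉ (there (there (here refl))) = ≢z refl

holes-skip : ∀ a n T t → holes a (replicate n 0 ++ T) t ≡ holes (a + n) T t
holes-skip a zero    T t = cong (λ a → holes a T t) (sym (+-identityʳ a))
holes-skip a (suc n) T t = trans (holes-skip (suc a) n T t) (cong (λ a → holes a T t) (sym (+-suc a n)))

limit-skip : ∀ a n T t → limit a (replicate n 0 ++ T) t ≡ limit (a + n) T t
limit-skip a zero    T t = cong (λ a → limit a T t) (sym (+-identityʳ a))
limit-skip a (suc n) T t = trans (limit-skip (suc a) n T t) (cong (λ a → limit a T t) (sym (+-suc a n)))

-- The weight equation describes the partitions of 3 into parts of two colours, one for each end of
-- the set; there are ten.
unit-framed⇒exceptional : ∀ N p₁ p₂ p₃ q₃ q₂ q₁ {B} → B ↭ elements 0 (framed p₁ p₂ p₃ N 0 q₃ q₂ q₁) →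
  corner-weight p₁ p₂ p₃ + corner-weight q₁ q₂ q₃ ≡ 3 →
  Any (IsIntervalMinus (map +_ B) (7 + N)) (exceptionalTriples (7 + N))
unit-framed⇒exceptional N p₁ p₂ p₃ q₃ q₂ q₁ {B} B↭ wt = subst (Any (IsIntervalMinus (map +_ B) (7 + N))) (sym numerals) (cases p₃ p₂ p₁ q₃ q₂ q₁ B↭ wt)
  where
  L : List (ℤ × ℤ × ℤ)
  L = (+ 1 , + 2 , + 3) ∷ (+ (6 + N) , + (7 + N) , + (8 + N)) ∷ (+ 1 , + 2 , + (8 + N)) ∷ (+ 1 , + (7 + N) , + (8 + N))
    ∷ (+ 1 , + 3 , + (9 + N)) ∷ (+ (5 + N) , + (7 + N) , + (9 + N)) ∷ (+ 2 , + (7 + N) , + (9 + N))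
    ∷ (+ 1 , + (6 + N) , + (9 + N)) ∷ (+ 3 , + (8 + N) , + (9 + N)) ∷ (+ (4 + N) , + (8 + N) , + (9 + N)) ∷ []
  numerals : exceptionalTriples (7 + N) ≡ L
  numerals rewrite +-comm N 1 | +-comm N 2 = refl
  form : ∀ p₁ p₂ p₃ q₃ q₂ q₁ t {x y z} → B ↭ elements 0 (framed p₁ p₂ p₃ N 0 q₃ q₂ q₁) →
         limit (suc (p₃ + suc (p₂ + suc (p₁ + 0))) + N) (q₃ ∷ q₂ ∷ q₁ ∷ []) t ≡ 9 + N →
         range 1 p₁ ++ range (2 + (p₁ + 0)) p₂ ++ range (2 + (p₂ + suc (p₁ + 0))) p₃ ++
           holes (suc (p₃ + suc (p₂ + suc (p₁ + 0))) + N) (q₃ ∷ q₂ ∷ q₁ ∷ []) t ≡ x ∷ y ∷ z ∷ [] →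
         IsIntervalMinus (map +_ B) (7 + N) (+ x , + y , + z)
  form p₁ p₂ p₃ q₃ q₂ q₁ t r l e = interval-minus {k = 7 + N} (framed p₁ p₂ p₃ N 0 q₃ q₂ q₁) t r
    (trans (limit-skip (suc (p₃ + suc (p₂ + suc (p₁ + 0)))) N (q₃ ∷ q₂ ∷ q₁ ∷ []) t) (trans l (cong (_+_ 7) (+-comm 2 N))))
    (trans (cong (λ H → range 1 p₁ ++ range (2 + (p₁ + 0)) p₂ ++ range (2 + (p₂ + suc (p₁ + 0))) p₃ ++ H)
             (holes-skip (suc (p₃ + suc (p₂ + suc (p₁ + 0)))) N (q₃ ∷ q₂ ∷ q₁ ∷ []) t)) e)
  cases : ∀ p₃ p₂ p₁ q₃ q₂ q₁ → B ↭ elements 0 (framed p₁ p₂ p₃ N 0 q₃ q₂ q₁) →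
          corner-weight p₁ p₂ p₃ + corner-weight q₁ q₂ q₃ ≡ 3 → Any (IsIntervalMinus (map +_ B) (7 + N)) L
  -- The number before `r` is 3 minus the sum of the gaps: by this much `k + 2` exceeds the maximum
  -- of the set, and the points above the maximum count as missing.
  cases 0 0 3 0 0 0 r _ = here (form 3 0 0 0 0 0 0 r refl refl)
  cases 0 0 0 0 0 3 r _ = there (here (form 0 0 0 0 0 3 0 r refl refl))
  cases 0 0 2 0 0 1 r _ = there (there (here (form 2 0 0 0 0 1 0 r refl refl)))
  cases 0 0 1 0 0 2 r _ = there (there (there (here (form 1 0 0 0 0 2 0 r refl refl))))
  cases 0 1 1 0 0 0 r _ = there (there (there (there (here (form 1 1 0 0 0 0 1 r refl refl)))))
  cases 0 0 0 0 1 1 r _ = there (there (there (there (there (here (form 0 0 0 0 1 1 1 r refl refl))))))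
  cases 0 1 0 0 0 1 r _ = there (there (there (there (there (there (here (form 0 1 0 0 0 1 1 r refl refl)))))))
  cases 0 0 1 0 1 0 r _ = there (there (there (there (there (there (there (here (form 1 0 0 0 1 0 1 r refl refl))))))))
  cases 1 0 0 0 0 0 r _ = there (there (there (there (there (there (there (there (here (form 0 0 1 0 0 0 2 r refl refl)))))))))
  cases 0 0 0 1 0 0 r _ = there (there (there (there (there (there (there (there (there (here (form 0 0 0 1 0 0 2 r refl refl))))))))))

-- Assembly: unit difference, exact weight and reduction from the integers

length-elements : ∀ a E → length (elements a E) ≡ suc (length E)
length-elements a []      = refl
length-elements a (e ∷ E) = cong suc (length-elements (suc (e + a)) E)

corner-∣ : ∀ {d p₁ p₂ p₃ e} → Corner d p₁ p₂ p₃ e → suc d ∣ suc p₁ × suc d ∣ suc p₂ × suc d ∣ suc p₃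
corner-∣ c = divides (suc α₁) multiple₁ , divides (suc α₂) multiple₂ , divides (suc α₃) multiple₃
  where open Corner c

-- The sums fill at most one more place than `a * b` plus the total corner weight, and there are
-- `a * b + 4` of them.
corner-weight≥3 : ∀ h z B p₁ p₂ p₃ q₃ q₂ q₁ → let E = framed p₁ p₂ p₃ (12 + (h + z)) 0 q₃ q₂ q₁ in
  B ↭ elements 0 E → 5 + h + (14 + z) ≡ suc (length E) →
  length (restrictedSumset (5 + h) (map +_ B)) ≡ (5 + h) * (14 + z) + 4 →
  3 ≤ corner-weight p₁ p₂ p₃ + corner-weight q₁ q₂ q₃
corner-weight≥3 h z B p₁ p₂ p₃ q₃ q₂ q₁ B↭ size card =
  compare ((5 + h) * (14 + z)) (corner-weight p₁ p₂ p₃ + corner-weight q₁ q₂ q₃) card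
    (sumset≤range {framed p₁ p₂ p₃ (12 + (h + z)) 0 q₃ q₂ q₁} {5 + h} {14 + z} {B}
      B↭ size (value-range h z p₁ p₂ p₃ q₃ q₂ q₁))
  where
  compare : ∀ x t {l} → l ≡ x + 4 → l ≤ suc (x + t) → 3 ≤ t
  compare x t l≡ l≤ = s≤s⁻¹ (+-cancelˡ-≤ x 4 (suc t) (subst₂ _≤_ l≡ (sym (+-suc x t)) l≤))

framed⇒exceptional : ∀ h z {p₁ p₂ p₃ d q₃ q₂ q₁} B → let E = framed p₁ p₂ p₃ (12 + (h + z)) d q₃ q₂ q₁ in
  B ↭ elements 0 E → 5 + h + (14 + z) ≡ suc (length E) → gcdList (map +_ B) ≡ 1 →
  length (restrictedSumset (5 + h) (map +_ B)) ≡ (5 + h) * (14 + z) + 4 →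
  (∃ λ l → ∃ λ r → Corner d p₁ p₂ p₃ l × Corner d q₁ q₂ q₃ r × l + r ≤ 3) →
  Any (IsIntervalMinus (map +_ B) (7 + (12 + (h + z)))) (exceptionalTriples (7 + (12 + (h + z))))
framed⇒exceptional h z {p₁} {p₂} {p₃} {d} {q₃} {q₂} {q₁} B B↭ size gcd≡1 card (l , r , left , right , l+r≤3) = unit d≡0
  where
  divisible : All (λ e → suc d ∣ suc e) (framed p₁ p₂ p₃ (12 + (h + z)) d q₃ q₂ q₁)
  divisible with corner-∣ left | corner-∣ right
  ... | ∣p₁ , ∣p₂ , ∣p₃ | ∣q₁ , ∣q₂ , ∣q₃ =
    ∣p₁ ∷ ∣p₂ ∷ ∣p₃ ∷ ++⁺ (replicate⁺ (12 + (h + z)) ∣-refl) (∣q₃ ∷ ∣q₂ ∷ ∣q₁ ∷ [])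
  d≡0 : d ≡ 0
  -- All differences are multiples of `suc d` and the set starts at 0, so `suc d` divides every
  -- element and hence the gcd.
  d≡0 = suc-injective (∣1⇒≡1 (subst (suc d ∣_) gcd≡1
    (∣gcdList B (λ b∈ → All.lookup (elements-∣ _ (_ ∣0) divisible) (∈-resp-↭ B↭ b∈)))))
  unit : d ≡ 0 → Any (IsIntervalMinus (map +_ B) (7 + (12 + (h + z)))) (exceptionalTriples (7 + (12 + (h + z))))
  -- The chains bound the total corner weight by 3 from above, the range of the sums bounds it by 3
  -- from below.
  unit refl = unit-framed⇒exceptional (12 + (h + z)) p₁ p₂ p₃ q₃ q₂ q₁ B↭ (≤-antisym
    (subst (_≤ 3) (sym (cong₂ _+_ (corner-unit left) (corner-unit right))) l+r≤3)
    (corner-weight≥3 h z B p₁ p₂ p₃ q₃ q₂ q₁ B↭ size card))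

corner-pair : ∀ d p₁ p₂ p₃ q₁ q₂ q₃ → left-excess p₁ p₂ p₃ d + right-excess q₁ q₂ q₃ d ≤ 3 →
  ∃ λ l → ∃ λ r → Corner d p₁ p₂ p₃ l × Corner d q₁ q₂ q₃ r × l + r ≤ 3
corner-pair d p₁ p₂ p₃ q₁ q₂ q₃ le =
  _ , _ ,
  corner d p₁ p₂ p₃ refl (≤-trans (m≤m+n (left-excess p₁ p₂ p₃ d) (right-excess q₁ q₂ q₃ d)) le) ,
  corner d q₁ q₂ q₃ (sym (right≡left q₁ q₂ q₃ d)) (≤-trans (m≤n+m (right-excess q₁ q₂ q₃ d) (left-excess p₁ p₂ p₃ d)) le) ,
  le

small-excess : ∀ {E a b B} → B ↭ elements 0 E → a + b ≡ suc (length E) →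
  length (restrictedSumset a (map +_ B)) ≡ a * b + 4 → SmallExcess E a b
small-excess {E} {a} {b} {B} B↭ size card {e} c = compare (a * b) card (chain⇒sumset≥ {E} {a} {b} {B} {e} B↭ size c)
  where
  compare : ∀ x {l} → l ≡ x + 4 → suc (x + e) ≤ l → e ≤ 3
  compare x l≡ ≤l = s≤s⁻¹ (+-cancelˡ-≤ x (suc e) 4 (subst₂ _≤_ (sym (+-suc x e)) l≡ ≤l))

naturals⇒exceptional : ∀ h z B → Unique B → 0 ∈ B → length B ≡ 5 + h + (14 + z) → gcdList (map +_ B) ≡ 1 →
  length (restrictedSumset (5 + h) (map +_ B)) ≡ (5 + h) * (14 + z) + 4 →
  Any (IsIntervalMinus (map +_ B) (7 + (12 + (h + z)))) (exceptionalTriples (7 + (12 + (h + z))))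
naturals⇒exceptional h z B unique 0∈B len gcd≡1 card = encoded (gap-encoding B 0∈B unique)
  where
  Goal : Set
  Goal = Any (IsIntervalMinus (map +_ B) (7 + (12 + (h + z)))) (exceptionalTriples (7 + (12 + (h + z))))
  shaped : ∀ E → B ↭ elements 0 E → 5 + h + (14 + z) ≡ suc (length E) → SmallExcess E (5 + h) (14 + z) →
    (∃ λ p₁ → ∃ λ p₂ → ∃ λ p₃ → ∃ λ d → ∃ λ q₃ → ∃ λ q₂ → ∃ λ q₁ → E ≡ framed p₁ p₂ p₃ (12 + (h + z)) d q₃ q₂ q₁) →
    Goal
  shaped E B↭ size small (p₁ , p₂ , p₃ , d , q₃ , q₂ , q₁ , refl) =
    framed⇒exceptional h z {p₁} {p₂} {p₃} {d} {q₃} {q₂} {q₁} B B↭ size gcd≡1 card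
      (corner-pair d p₁ p₂ p₃ q₁ q₂ q₃ (corners h z {p₁} {p₂} {p₃} {d} {q₃} {q₂} {q₁} small))
  encoded : (∃ λ E → B ↭ elements 0 E) → Goal
  encoded (E , B↭) = shaped E B↭ size small (frame (h + z) E length-E (rigid h z E (sym size) small))
    where
    size : 5 + h + (14 + z) ≡ suc (length E)
    size = trans (sym len) (trans (↭-length B↭) (length-elements 0 E))
    small : SmallExcess E (5 + h) (14 + z)
    small = small-excess {E} {5 + h} {14 + z} {B} B↭ size card
    length-E : length E ≡ 18 + (h + z)
    length-E = suc-injective (trans (sym size)
      (solve 2 (λ h z → con 5 :+ h :+ (con 14 :+ z) := con 19 :+ (h :+ z)) refl h z))

integers⇒exceptional : ∀ h k g z A B → 5 + g ≡ h → k ≡ h + (14 + z) → A ≡ map +_ B →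
  Unique A → length A ≡ k → + 0 ∈ A → gcdList A ≡ 1 →
  length (restrictedSumset h A) ≡ h * (14 + z) + 4 →
  Any (IsIntervalMinus A k) (exceptionalTriples k)
integers⇒exceptional h k g z A B refl k≡ refl unique len 0∈A gcd≡1 card =
  subst (λ k → Any (IsIntervalMinus (map +_ B) k) (exceptionalTriples k)) (sym (trans k≡ split))
    (naturals⇒exceptional g z B (Unique.map⁻ unique) (zero-in (∈-map⁻ +_ 0∈A))
      (trans (sym (length-map +_ B)) (trans len k≡)) gcd≡1 card)
  where
  split : 5 + g + (14 + z) ≡ 19 + (g + z)
  split = solve 2 (λ g z → con 5 :+ g :+ (con 14 :+ z) := con 19 :+ (g :+ z)) refl g z
  zero-in : (∃ λ b → b ∈ B × + 0 ≡ + b) → 0 ∈ B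
  zero-in (_ , 0∈B , refl) = 0∈B

theorem1p15 : (h k : ℕ) → 5 ≤ h → 3 * h + 4 ≤ k →
    (A : List ℤ) → Unique A → length A ≡ k →
    MinIsZero A → gcdList A ≡ 1 →
    length (restrictedSumset h A) ≡ (h * k ∸ h * h) + 4 →
    Any (IsIntervalMinus A k) (exceptionalTriples k)
theorem1p15 h k 5≤h 3h+4≤k A unique len (0∈A , nonneg) gcd≡1 card =
  parametrised (m≤n⇒∃[o]m+o≡n 5≤h) (m≤n⇒∃[o]m+o≡n h+14≤k) (naturals A nonneg)
  where
  -- Since 5 ≤ h, the number 2h + 4 is at least 14.
  h+14≤k : h + 14 ≤ k
  h+14≤k = ≤-trans (+-monoʳ-≤ h (+-monoˡ-≤ 4 (*-monoʳ-≤ 2 5≤h)))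
             (≤-trans (≤-reflexive (solve 1 (λ h → h :+ (con 2 :* h :+ con 4) := con 3 :* h :+ con 4) refl h)) 3h+4≤k)
  cancel : ∀ b → k ≡ h + b → h * k ∸ h * h ≡ h * b
  cancel b refl = trans (cong (_∸ h * h) (*-distribˡ-+ h h b)) (m+n∸m≡n (h * h) (h * b))
  parametrised : (∃ λ g → 5 + g ≡ h) → (∃ λ z → h + 14 + z ≡ k) → (∃ λ B → A ≡ map +_ B) →
                 Any (IsIntervalMinus A k) (exceptionalTriples k)
  parametrised (g , 5+g≡h) (z , h+14+z≡k) (B , A≡) =
    integers⇒exceptional h k g z A B 5+g≡h k≡ A≡ unique len 0∈A gcd≡1 (trans card (cong (_+ 4) (cancel (14 + z) k≡)))
    where
    k≡ : k ≡ h + (14 + z)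
    k≡ = trans (sym h+14+z≡k) (+-assoc h 14 z)
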